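{- Every graph $G$ has a $\left(\leq 45\left(1+\frac{75}{9}\right)^{2|E(G)|-1}\right)$-subdivision $S$ with $\phi(S)\le 8$.
   Context: An anagram is a word of the form $WP$ where $W$ is a non-empty word and $P$ is a permutation of $W$. A vertex colouring of a graph is anagram-free if the sequence of colours along every path of the graph is not an anagram. $\phi(G)$ is the minimum number of colours in an anagram-free colouring of $G$. A subdivision of $G$ is obtained by replacing each edge $uv$ by a path with endpoints $u,v$; internal vertices are division vertices. A $(\le k)$-subdivision is a subdivision in which every edge receives at most $k$ division vertices. -}

module Defs where

open import Data.Nat using (ℕ; zero; suc; _+_; _*_; _∸_; _^_; _≤_)
open import Data.Fin using (Fin; toℕ)
open import Data.Product using (Σ; ∃; _×_; _,_; proj₁; proj₂)
open import Data.Sum using (_⊎_; inj₁; inj₂)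
open import Data.List using (List; []; _∷_; _++_; map)
open import Data.List.Relation.Unary.Linked using (Linked)
open import Data.List.Relation.Unary.Unique.Propositional using (Unique)
open import Data.List.Relation.Binary.Permutation.Propositional using (_↭_)
open import Relation.Binary.PropositionalEquality using (_≡_; _≢_)
open import Relation.Nullary using (¬_)

record Graph : Set where
  field
    n : ℕ
    m : ℕ
    ends : Fin m → Fin n × Fin n
    loopless : ∀ i → proj₁ (ends i) ≢ proj₂ (ends i)
    simple : ∀ i j → (proj₁ (ends i) ≡ proj₁ (ends j) × proj₂ (ends i) ≡ proj₂ (ends j))
                   ⊎ (proj₁ (ends i) ≡ proj₂ (ends j) × proj₂ (ends i) ≡ proj₁ (ends j))
                   → i ≡ j

IsPath : {V : Set} → (V → V → Set) → List V → Set
IsPath Adj p = Unique p × Linked Adj p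

IsAnagram : {C : Set} → List C → Set
IsAnagram {C} w = Σ (List C) λ W → Σ (List C) λ P → W ≢ [] × P ↭ W × w ≡ W ++ P

AnagramFree : {V C : Set} → (V → V → Set) → (V → C) → Set
AnagramFree Adj c = ∀ p → IsPath Adj p → ¬ IsAnagram (map c p)

φ≤ : {V : Set} → (V → V → Set) → ℕ → Set
φ≤ {V} Adj k = Σ (V → Fin k) λ c → AnagramFree Adj c

module Subdivision (G : Graph) (k : Fin (Graph.m G) → ℕ) where
  open Graph G

  -- vertices of the subdivision: original vertices and division vertices;
  -- edge i receives k i division vertices, (i , 0) … (i , k i - 1), in order from
  -- proj₁ (ends i) to proj₂ (ends i).
  SV : Set
  SV = Fin n ⊎ Σ (Fin m) (λ i → Fin (k i))

  data Step : SV → SV → Set where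
    direct : ∀ i → k i ≡ 0 → Step (inj₁ (proj₁ (ends i))) (inj₁ (proj₂ (ends i)))
    first  : ∀ i (j : Fin (k i)) → toℕ j ≡ 0 → Step (inj₁ (proj₁ (ends i))) (inj₂ (i , j))
    middle : ∀ i (j j' : Fin (k i)) → toℕ j' ≡ suc (toℕ j) → Step (inj₂ (i , j)) (inj₂ (i , j'))
    last   : ∀ i (j : Fin (k i)) → suc (toℕ j) ≡ k i → Step (inj₂ (i , j)) (inj₁ (proj₂ (ends i)))

  SAdj : SV → SV → Set
  SAdj x y = Step x y ⊎ Step y x

-- The bound 45 (1 + 75/9)^(2|E|-1) = 45 (28/3)^(2|E|-1); for a natural number t,
-- t ≤ 45 (28/3)^e  ⇔  t * 3^e ≤ 45 * 28^e.
WithinBound : ℕ → ℕ → Set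
WithinBound e t = t * 3 ^ e ≤ 45 * 28 ^ e

{-# OPTIONS --safe #-}

-- Edge number e (counted from 0) receives 4 · 85^e division vertices, in four regions of length 85^e.
-- Each region carries Keränen's abelian-square-free word over {a,b,c,d}; b, c, d are colours common to
-- all regions, while a is replaced by a colour, the mark, that depends on the region number 0, …, 3.
-- Together with one colour for the original vertices this makes eight.
--
-- Let L R be a path whose halves have equal colour counts. Some region number j avoids the first and last
-- vertices of the path and the last vertex of L, so each half contains all or nothing of any region numbered j.
-- On the largest edge that is met, such a region has more marks j than all smaller edges have together, so the
-- halves could not balance: the path misses all regions numbered j. Hence it crosses no edge completely and has
-- at most one original vertex, and by balance none. So it stays inside one edge, where marks at both ends of
-- each region confine it to a single region, contradicting Keränen's theorem.
module Submission where

open import Defs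
open import Data.Bool using (Bool; true; if_then_else_; T)
open import Data.Bool.ListAction using (all)
open import Data.Empty using (⊥; ⊥-elim)
open import Data.Fin using (Fin; zero; suc; toℕ; fromℕ<; combine; remQuot; #_)
import Data.Fin.Properties as Fin
open import Data.List using (List; []; _∷_; _++_; map; filter; length; tabulate; upTo; applyUpTo; allFin)
open import Data.List.Properties using (length-++; length-tabulate; length-++-sucʳ; ∷-injective)
open import Data.List.Membership.Propositional using (_∈_; _∉_)
open import Data.List.Membership.Propositional.Properties
open import Data.List.Relation.Binary.Disjoint.Propositional using (Disjoint)
open import Data.List.Relation.Binary.Permutation.Propositional using (_↭_; refl; prep; swap; trans)
open import Data.List.Relation.Binary.Permutation.Propositional.Properties using (↭-length)
open import Data.List.Relation.Unary.All as All using (All; []; _∷_)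
open import Data.List.Relation.Unary.AllPairs using ([]; _∷_)
open import Data.List.Relation.Unary.Any using (here; there)
open import Data.List.Relation.Unary.Linked using (Linked; []; [-]; _∷_)
open import Data.List.Relation.Unary.Unique.Propositional using (Unique)
import Data.List.Relation.Unary.Unique.Propositional.Properties as Unique
open import Data.Nat
open import Data.Nat.DivMod
open import Data.Nat.Divisibility using (divides-refl; ∣-refl)
open import Data.Nat.Properties
open import Data.Nat.Solver using (module +-*-Solver)
open import Data.Product using (Σ; _×_; _,_; ∃; ∃₂; proj₁; proj₂)
open import Data.Sum using (_⊎_; inj₁; inj₂)
open import Function using (_∘_)
open import Relation.Binary using (Tri; tri<; tri≈; tri>)
open import Relation.Binary.PropositionalEquality hiding (trans)
import Relation.Binary.PropositionalEquality as ≡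
open import Relation.Nullary using (¬_; Dec; does; yes; no; ¬?)
open import Relation.Nullary.Decidable using (_×-dec_; _→-dec_; dec-true; dec-false)

open +-*-Solver using (solve; _:=_; _:+_; _:*_; con)

-- Keränen's morphism and the finite check

indicator : ∀ {k} → Fin k → Fin k → ℕ
indicator i j = if does (i Fin.≟ j) then 1 else 0

count : ∀ {k} → (ℕ → Fin k) → Fin k → ℕ → ℕ
count f y zero    = 0
count f y (suc t) = indicator (f t) y + count f y t

pattern 𝕒 = zero
pattern 𝕓 = suc zero
pattern 𝕔 = suc (suc zero)
pattern 𝕕 = suc (suc (suc zero))

keränen : List (Fin 4)
keränen =
  𝕒 ∷ 𝕓 ∷ 𝕔 ∷ 𝕒 ∷ 𝕔 ∷ 𝕕 ∷ 𝕔 ∷ 𝕓 ∷ 𝕔 ∷ 𝕕 ∷ 𝕔 ∷ 𝕒 ∷ 𝕕 ∷ 𝕔 ∷ 𝕕 ∷ 𝕓 ∷ 𝕕 ∷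
  𝕒 ∷ 𝕓 ∷ 𝕒 ∷ 𝕔 ∷ 𝕒 ∷ 𝕓 ∷ 𝕒 ∷ 𝕕 ∷ 𝕓 ∷ 𝕒 ∷ 𝕓 ∷ 𝕔 ∷ 𝕓 ∷ 𝕕 ∷ 𝕓 ∷ 𝕔 ∷ 𝕓 ∷
  𝕒 ∷ 𝕔 ∷ 𝕓 ∷ 𝕔 ∷ 𝕕 ∷ 𝕔 ∷ 𝕒 ∷ 𝕔 ∷ 𝕓 ∷ 𝕒 ∷ 𝕓 ∷ 𝕕 ∷ 𝕒 ∷ 𝕓 ∷ 𝕒 ∷ 𝕔 ∷ 𝕒 ∷
  𝕕 ∷ 𝕔 ∷ 𝕓 ∷ 𝕔 ∷ 𝕕 ∷ 𝕔 ∷ 𝕒 ∷ 𝕔 ∷ 𝕕 ∷ 𝕓 ∷ 𝕔 ∷ 𝕓 ∷ 𝕒 ∷ 𝕔 ∷ 𝕓 ∷ 𝕔 ∷ 𝕕 ∷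
  𝕔 ∷ 𝕒 ∷ 𝕔 ∷ 𝕕 ∷ 𝕔 ∷ 𝕓 ∷ 𝕕 ∷ 𝕔 ∷ 𝕕 ∷ 𝕒 ∷ 𝕕 ∷ 𝕓 ∷ 𝕕 ∷ 𝕔 ∷ 𝕓 ∷ 𝕔 ∷ 𝕒 ∷
  []

rotate : Fin 4 → Fin 4
rotate 𝕒 = 𝕓
rotate 𝕓 = 𝕔
rotate 𝕔 = 𝕕
rotate 𝕕 = 𝕒

shift : Fin 4 → Fin 4 → Fin 4
shift 𝕒 y = y
shift 𝕓 y = rotate y
shift 𝕔 y = rotate (rotate y)
shift 𝕕 y = rotate (rotate (rotate y))

nth : List (Fin 4) → ℕ → Fin 4
nth []       _       = 𝕒
nth (y ∷ _)  zero    = y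
nth (_ ∷ ys) (suc t) = nth ys t

-- Keränen's 85-uniform morphism: h x r is letter r of the image of x.
h : Fin 4 → ℕ → Fin 4
h x r = shift x (nth keränen r)

quad : ℕ → ℕ → ℕ → ℕ → Fin 4 → ℕ
quad p q r s 𝕒 = p
quad p q r s 𝕓 = q
quad p q r s 𝕔 = r
quad p q r s 𝕕 = s

-- incidence y x is the number of occurrences of y in the image of x.
incidence : Fin 4 → Fin 4 → ℕ
incidence 𝕒 = quad 19 18 27 21
incidence 𝕓 = quad 21 19 18 27
incidence 𝕔 = quad 27 21 19 18
incidence 𝕕 = quad 18 27 21 19

dot : (Fin 4 → ℕ) → (Fin 4 → ℕ) → ℕ
dot u v = u 𝕒 * v 𝕒 + u 𝕓 * v 𝕓 + u 𝕔 * v 𝕔 + u 𝕕 * v 𝕕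

-- The incidence matrix has determinant ± 43435 = 85 · 7 · 73, and modulo 43435 this form generates
-- the linear forms that vanish on its image.
weight : (Fin 4 → ℕ) → ℕ
weight = dot (quad 1 30176 19636 39101)

-- A position t = 85 q + r of the image of a word w cuts the image of letter q of w at offset r; parikh counts
-- the letters before the offset.
record Cut : Set where
  constructor cut
  field
    letter  : Fin 4
    offset  : ℕ
    parikh  : Fin 4 → ℕ
    load    : ℕ

open Cut

-- Complete blocks have weight 0 modulo 43435, so the load of the partial block is all that the
-- weight sees of a prefix.
cutAt : ℕ → Fin 4 → Cut
cutAt r x = cut x r π (weight π % 43435)
  where
  π : Fin 4 → ℕ
  π = quad (count (h x) 𝕒 r) (count (h x) 𝕓 r) (count (h x) 𝕔 r) (count (h x) 𝕕 r)

-- If i < j < k cut the image of w into an abelian square, then rounding each cut up (ε = 1) or down (ε = 0) to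
-- a block boundary gives a balanced triple of positions of w. The last condition excludes that all three
-- boundaries coincide. Rounding up needs a positive offset, hence ε ≤ offset.
Resolves : Cut → Cut → Cut → ℕ → ℕ → ℕ → Set
Resolves C₀ C₁ C₂ ε₀ ε₁ ε₂ =
  ε₀ ≤ offset C₀ × ε₁ ≤ offset C₁ × ε₂ ≤ offset C₂ ×
  (∀ y → (parikh C₀ y + parikh C₂ y) + 2 * (ε₁ * incidence y (letter C₁))
       ≡ 2 * parikh C₁ y + (ε₀ * incidence y (letter C₀) + ε₂ * incidence y (letter C₂))) ×
  ((ε₀ ≡ ε₁ → letter C₀ ≡ letter C₁) → (ε₁ ≡ ε₂ → letter C₁ ≡ letter C₂) →
    offset C₁ + 85 * ε₀ ≤ offset C₀ + 85 * ε₁)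

Resolvable : Cut → Cut → Cut → Set
Resolvable C₀ C₁ C₂ =
  ∃ λ (ε₀ : Fin 2) → ∃ λ (ε₁ : Fin 2) → ∃ λ (ε₂ : Fin 2) → Resolves C₀ C₁ C₂ (toℕ ε₀) (toℕ ε₁) (toℕ ε₂)

resolvable? : ∀ C₀ C₁ C₂ → Dec (Resolvable C₀ C₁ C₂)
resolvable? C₀ C₁ C₂ = Fin.any? λ ε₀ → Fin.any? λ ε₁ → Fin.any? λ ε₂ →
  (_ ≤? _) ×-dec (_ ≤? _) ×-dec (_ ≤? _) ×-dec (Fin.all? λ y → _ ≟ _) ×-dec
  (((_ ≟ _) →-dec (_ Fin.≟ _)) →-dec (((_ ≟ _) →-dec (_ Fin.≟ _)) →-dec (_ ≤? _)))

nthRow : List (List Cut) → ℕ → List Cut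
nthRow []         _       = []
nthRow (R ∷ _)    zero    = R
nthRow (_ ∷ rows) (suc r) = nthRow rows r

-- Triples with incompatible loads cannot come from an abelian square and pass by default; only the
-- others need a search for roundings.
middle-ok : Cut → Cut → ℕ → Cut → Bool
middle-ok C₀ C₂ s C₁ = if s ≡ᵇ (2 * load C₁) % 43435 then does (resolvable? C₀ C₁ C₂) else true

-- The middle offset is half the sum of the outer ones modulo 85, and 43 is the inverse of 2.
all-ok : List (List Cut) → Bool
all-ok rows =
  all (all λ C₀ → all (all λ C₂ →
    all (middle-ok C₀ C₂ ((load C₀ + load C₂) % 43435)) (nthRow rows ((43 * (offset C₀ + offset C₂)) % 85))) rows) rows

row : ℕ → List Cut
row r = map (cutAt r) (allFin 4)

-- Settled by evaluation: 340 choices for each outer cut and four letters for the middle one.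
all-ok-rows : all-ok (map row (upTo 85)) ≡ true
all-ok-rows = refl

-- Soundness of the finite check

all-sound : ∀ {A : Set} (p : A → Bool) {x xs} → all p xs ≡ true → x ∈ xs → p x ≡ true
all-sound p {xs = y ∷ _} eq (here refl) with p y
... | true = refl
all-sound p {xs = y ∷ _} eq (there x∈) with p y
... | true = all-sound p eq x∈

nthRow-map : ∀ (F : ℕ → List Cut) g {n r} → r < n → nthRow (map F (applyUpTo g n)) r ≡ F (g r)
nthRow-map F g {suc n} {zero}  _         = refl
nthRow-map F g {suc n} {suc r} (s≤s r<n) = nthRow-map F (g ∘ suc) r<n

∈-row : ∀ r x → cutAt r x ∈ row r
∈-row r x = ∈-map⁺ (cutAt r) (∈-allFin x)

all-ok-sound : ∀ {rows} → all-ok rows ≡ true →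
  ∀ {R₀ C₀ R₂ C₂ C₁} → R₀ ∈ rows → C₀ ∈ R₀ → R₂ ∈ rows → C₂ ∈ R₂ →
  C₁ ∈ nthRow rows ((43 * (offset C₀ + offset C₂)) % 85) →
  middle-ok C₀ C₂ ((load C₀ + load C₂) % 43435) C₁ ≡ true
all-ok-sound ok R₀∈ C₀∈ R₂∈ C₂∈ C₁∈ =
  all-sound _ (all-sound _ (all-sound _ (all-sound _ (all-sound _ ok R₀∈) C₀∈) R₂∈) C₂∈) C₁∈

if-true : ∀ {p q : Bool} → (if p then q else true) ≡ true → T p → q ≡ true
if-true {true} eq _ = eq

does-true : ∀ {A : Set} (A? : Dec A) → does A? ≡ true → A
does-true (yes x) _ = x

middle-ok-sound : ∀ C₀ C₂ s C₁ → middle-ok C₀ C₂ s C₁ ≡ true → s ≡ (2 * load C₁) % 43435 → Resolvable C₀ C₁ C₂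
middle-ok-sound C₀ C₂ s C₁ ok bal = does-true (resolvable? C₀ C₁ C₂) (if-true ok (≡⇒≡ᵇ s _ bal))

-- The table is kept as a variable, so that the argument does not refer to its concrete entries;
-- `resolvable` instantiates it.
resolvable-in : ∀ {rows : List (List Cut)} → all-ok rows ≡ true →
  (∀ {r} → r < 85 → row r ∈ rows) → (∀ {r} → r < 85 → nthRow rows r ≡ row r) →
  ∀ x₀ x₁ x₂ {r₀ r₁ r₂} → r₀ < 85 → r₁ < 85 → r₂ < 85 → (43 * (r₀ + r₂)) % 85 ≡ r₁ →
  (load (cutAt r₀ x₀) + load (cutAt r₂ x₂)) % 43435 ≡ (2 * load (cutAt r₁ x₁)) % 43435 →
  Resolvable (cutAt r₀ x₀) (cutAt r₁ x₁) (cutAt r₂ x₂)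
resolvable-in {rows} ok row∈ nthRow≡ x₀ x₁ x₂ {r₀} {r₁} {r₂} r₀< r₁< r₂< mid =
  middle-ok-sound (cutAt r₀ x₀) (cutAt r₂ x₂) _ (cutAt r₁ x₁)
    (all-ok-sound {rows} ok {C₀ = cutAt r₀ x₀} {C₂ = cutAt r₂ x₂} (row∈ r₀<) (∈-row r₀ x₀) (row∈ r₂<) (∈-row r₂ x₂)
      (subst (cutAt r₁ x₁ ∈_) (sym (≡.trans (cong (nthRow rows) mid) (nthRow≡ r₁<))) (∈-row r₁ x₁)))

resolvable : ∀ x₀ x₁ x₂ {r₀ r₁ r₂} → r₀ < 85 → r₁ < 85 → r₂ < 85 → (43 * (r₀ + r₂)) % 85 ≡ r₁ →
  (load (cutAt r₀ x₀) + load (cutAt r₂ x₂)) % 43435 ≡ (2 * load (cutAt r₁ x₁)) % 43435 →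
  Resolvable (cutAt r₀ x₀) (cutAt r₁ x₁) (cutAt r₂ x₂)
resolvable = resolvable-in {map row (upTo 85)} all-ok-rows (λ r< → ∈-map⁺ row (∈-upTo⁺ r<)) (nthRow-map row (λ r → r))

-- Abelian-square-freeness of Keränen's word

count-cong : ∀ {k} {f g : ℕ → Fin k} y t → (∀ {s} → s < t → f s ≡ g s) → count f y t ≡ count g y t
count-cong y zero    eq = refl
count-cong y (suc t) eq = cong₂ _+_ (cong (λ x → indicator x y) (eq ≤-refl)) (count-cong y t (eq ∘ m<n⇒m<1+n))

count-+ : ∀ {k} (f : ℕ → Fin k) y m t → count f y (m + t) ≡ count f y m + count (λ s → f (m + s)) y t
count-+ f y m zero    = ≡.trans (cong (count f y) (+-identityʳ m)) (sym (+-identityʳ _))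
count-+ f y m (suc t) rewrite +-suc m t | count-+ f y m t =
  solve 3 (λ i p q → i :+ (p :+ q) := p :+ (i :+ q)) refl (indicator (f (m + t)) y) (count f y m) _

-- Linear forms in letter counts and the incidence matrix

dot-cong : ∀ w {u v} → (∀ x → u x ≡ v x) → dot w u ≡ dot w v
dot-cong w eq rewrite eq 𝕒 | eq 𝕓 | eq 𝕔 | eq 𝕕 = refl

dot-congˡ : ∀ {u v} w → (∀ x → u x ≡ v x) → dot u w ≡ dot v w
dot-congˡ w eq rewrite eq 𝕒 | eq 𝕓 | eq 𝕔 | eq 𝕕 = refl

dot-+ : ∀ w u v → dot w (λ x → u x + v x) ≡ dot w u + dot w v
dot-+ w u v = solve 12 (λ i j k l p q r s p′ q′ r′ s′ →
    i :* (p :+ p′) :+ j :* (q :+ q′) :+ k :* (r :+ r′) :+ l :* (s :+ s′)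
    := (i :* p :+ j :* q :+ k :* r :+ l :* s) :+ (i :* p′ :+ j :* q′ :+ k :* r′ :+ l :* s′)) refl
  (w 𝕒) (w 𝕓) (w 𝕔) (w 𝕕) (u 𝕒) (u 𝕓) (u 𝕔) (u 𝕕) (v 𝕒) (v 𝕓) (v 𝕔) (v 𝕕)

dot-+ˡ : ∀ u v w → dot (λ x → u x + v x) w ≡ dot u w + dot v w
dot-+ˡ u v w = solve 12 (λ i j k l p q r s p′ q′ r′ s′ →
    (p :+ p′) :* i :+ (q :+ q′) :* j :+ (r :+ r′) :* k :+ (s :+ s′) :* l
    := (p :* i :+ q :* j :+ r :* k :+ s :* l) :+ (p′ :* i :+ q′ :* j :+ r′ :* k :+ s′ :* l)) refl
  (w 𝕒) (w 𝕓) (w 𝕔) (w 𝕕) (u 𝕒) (u 𝕓) (u 𝕔) (u 𝕕) (v 𝕒) (v 𝕓) (v 𝕔) (v 𝕕)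

dot-* : ∀ n w u → dot w (λ x → n * u x) ≡ n * dot w u
dot-* n w u = solve 9 (λ n i j k l p q r s →
    i :* (n :* p) :+ j :* (n :* q) :+ k :* (n :* r) :+ l :* (n :* s) := n :* (i :* p :+ j :* q :+ k :* r :+ l :* s)) refl
  n (w 𝕒) (w 𝕓) (w 𝕔) (w 𝕕) (u 𝕒) (u 𝕓) (u 𝕔) (u 𝕕)

dot-*ˡ : ∀ u w n → dot (λ x → u x * n) w ≡ dot u w * n
dot-*ˡ u w n = solve 9 (λ n i j k l p q r s →
    p :* n :* i :+ q :* n :* j :+ r :* n :* k :+ s :* n :* l := (p :* i :+ q :* j :+ r :* k :+ s :* l) :* n) refl
  n (w 𝕒) (w 𝕓) (w 𝕔) (w 𝕕) (u 𝕒) (u 𝕓) (u 𝕔) (u 𝕕)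

dot-indicator : ∀ w x → dot w (indicator x) ≡ w x
dot-indicator w 𝕒 = solve 4 (λ i j k l → i :* con 1 :+ j :* con 0 :+ k :* con 0 :+ l :* con 0 := i) refl (w 𝕒) (w 𝕓) (w 𝕔) (w 𝕕)
dot-indicator w 𝕓 = solve 4 (λ i j k l → i :* con 0 :+ j :* con 1 :+ k :* con 0 :+ l :* con 0 := j) refl (w 𝕒) (w 𝕓) (w 𝕔) (w 𝕕)
dot-indicator w 𝕔 = solve 4 (λ i j k l → i :* con 0 :+ j :* con 0 :+ k :* con 1 :+ l :* con 0 := k) refl (w 𝕒) (w 𝕓) (w 𝕔) (w 𝕕)
dot-indicator w 𝕕 = solve 4 (λ i j k l → i :* con 0 :+ j :* con 0 :+ k :* con 0 :+ l :* con 1 := l) refl (w 𝕒) (w 𝕓) (w 𝕔) (w 𝕕)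

dot-comm : ∀ u v → dot u v ≡ dot v u
dot-comm u v = cong₂ _+_ (cong₂ _+_ (cong₂ _+_ (*-comm (u 𝕒) _) (*-comm (u 𝕓) _)) (*-comm (u 𝕔) _)) (*-comm (u 𝕕) _)

-- Multiplication by the incidence matrix: it takes the letter counts of a word to those of its
-- image under the morphism.
apply : (Fin 4 → ℕ) → Fin 4 → ℕ
apply u y = dot (incidence y) u

transposed : (Fin 4 → ℕ) → Fin 4 → ℕ
transposed w x = dot w (λ y → incidence y x)

-- A double sum over pairs of letters, evaluated in the other order.
dot-apply : ∀ w u → dot w (apply u) ≡ dot (transposed w) u
dot-apply w u = begin
  dot w (apply u)
    ≡⟨ dot-+ w (λ y → m y 𝕒 + m y 𝕓 + m y 𝕔) (λ y → m y 𝕕) ⟩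
  dot w (λ y → m y 𝕒 + m y 𝕓 + m y 𝕔) + dot w (λ y → m y 𝕕)
    ≡⟨ cong (_+ dot w (λ y → m y 𝕕)) (dot-+ w (λ y → m y 𝕒 + m y 𝕓) (λ y → m y 𝕔)) ⟩
  dot w (λ y → m y 𝕒 + m y 𝕓) + dot w (λ y → m y 𝕔) + dot w (λ y → m y 𝕕)
    ≡⟨ cong (λ s → s + dot w (λ y → m y 𝕔) + dot w (λ y → m y 𝕕)) (dot-+ w (λ y → m y 𝕒) (λ y → m y 𝕓)) ⟩
  dot w (λ y → m y 𝕒) + dot w (λ y → m y 𝕓) + dot w (λ y → m y 𝕔) + dot w (λ y → m y 𝕕)
    ≡⟨ cong₂ _+_ (cong₂ _+_ (cong₂ _+_ (scale 𝕒) (scale 𝕓)) (scale 𝕔)) (scale 𝕕) ⟩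
  dot (transposed w) u ∎
  where
  open ≡-Reasoning
  m : Fin 4 → Fin 4 → ℕ
  m y x = incidence y x * u x
  scale : ∀ x → dot w (λ y → m y x) ≡ transposed w x * u x
  scale x = ≡.trans (dot-comm w (λ y → m y x)) (≡.trans (dot-*ˡ (λ y → incidence y x) w (u x)) (cong (_* u x) (dot-comm (λ y → incidence y x) w)))

-- Pulled back through the incidence matrix, the weight has coefficients 43, 47, 40, 44 times 43435.
-- Hence images of whole words have weight 0 modulo 43435.
weight-apply : ∀ u → weight (apply u) ≡ dot (quad 43 47 40 44) u * 43435
weight-apply u = ≡.trans (dot-apply (quad 1 30176 19636 39101) u) (≡.trans
  (dot-congˡ {transposed (quad 1 30176 19636 39101)} {λ x → quad 43 47 40 44 x * 43435} u (λ { 𝕒 → refl ; 𝕓 → refl ; 𝕔 → refl ; 𝕕 → refl }))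
  (dot-*ˡ (quad 43 47 40 44) u 43435))

-- Positive and negative parts of 43435 times the inverse of the incidence matrix.
adjugate⁺ adjugate⁻ : Fin 4 → Fin 4 → ℕ
adjugate⁺ 𝕒 = quad 0 0 4059 0
adjugate⁺ 𝕓 = quad 0 0 0 4059
adjugate⁺ 𝕔 = quad 4059 0 0 0
adjugate⁺ 𝕕 = quad 0 4059 0 0
adjugate⁻ 𝕒 = quad 701 531 0 2316
adjugate⁻ 𝕓 = quad 2316 701 531 0
adjugate⁻ 𝕔 = quad 0 2316 701 531
adjugate⁻ 𝕕 = quad 531 0 2316 701

adjugate-inverts : ∀ x z → transposed (adjugate⁺ x) z ≡ transposed (adjugate⁻ x) z + indicator x z * 43435
adjugate-inverts 𝕒 𝕒 = refl
adjugate-inverts 𝕒 𝕓 = refl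
adjugate-inverts 𝕒 𝕔 = refl
adjugate-inverts 𝕒 𝕕 = refl
adjugate-inverts 𝕓 𝕒 = refl
adjugate-inverts 𝕓 𝕓 = refl
adjugate-inverts 𝕓 𝕔 = refl
adjugate-inverts 𝕓 𝕕 = refl
adjugate-inverts 𝕔 𝕒 = refl
adjugate-inverts 𝕔 𝕓 = refl
adjugate-inverts 𝕔 𝕔 = refl
adjugate-inverts 𝕔 𝕕 = refl
adjugate-inverts 𝕕 𝕒 = refl
adjugate-inverts 𝕕 𝕓 = refl
adjugate-inverts 𝕕 𝕔 = refl
adjugate-inverts 𝕕 𝕕 = refl

dot-inverts : ∀ {w⁺ w⁻} x N → (∀ z → transposed w⁺ z ≡ transposed w⁻ z + indicator x z * N) →
  ∀ u → dot w⁺ (apply u) ≡ dot w⁻ (apply u) + u x * N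
dot-inverts {w⁺} {w⁻} x N eq u = begin
  dot w⁺ (apply u)                                              ≡⟨ dot-apply w⁺ u ⟩
  dot (transposed w⁺) u                                         ≡⟨ dot-congˡ {transposed w⁺} {λ z → transposed w⁻ z + indicator x z * N} u eq ⟩
  dot (λ z → transposed w⁻ z + indicator x z * N) u             ≡⟨ dot-+ˡ (transposed w⁻) (λ z → indicator x z * N) u ⟩
  dot (transposed w⁻) u + dot (λ z → indicator x z * N) u       ≡⟨ cong₂ _+_ (sym (dot-apply w⁻ u)) (dot-*ˡ (indicator x) u N) ⟩
  dot w⁻ (apply u) + dot (indicator x) u * N                    ≡⟨ cong (λ s → dot w⁻ (apply u) + s * N) (≡.trans (dot-comm (indicator x) u) (dot-indicator u x)) ⟩
  dot w⁻ (apply u) + u x * N                                    ∎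
  where open ≡-Reasoning

-- The incidence matrix is nonsingular: a row of the adjugate recovers 43435 times one coordinate,
-- and this factor cancels.
apply-injective : ∀ {u v} → (∀ y → apply u y ≡ apply v y) → ∀ x → u x ≡ v x
apply-injective {u} {v} eq x = cancel (dot-inverts {w⁺} {w⁻} x 43435 (adjugate-inverts x))
  where
  w⁺ = adjugate⁺ x
  w⁻ = adjugate⁻ x
  -- The factor 43435 is generalised to a variable `N`, so that the cancellation does not depend on
  -- the numeral.
  cancel : ∀ {N} .{{_ : NonZero N}} → (∀ u → dot w⁺ (apply u) ≡ dot w⁻ (apply u) + u x * N) → u x ≡ v x
  cancel {N} inv = *-cancelʳ-≡ _ _ N (+-cancelˡ-≡ (dot w⁻ (apply v)) _ _ (begin
    dot w⁻ (apply v) + u x * N  ≡⟨ cong (_+ u x * N) (dot-cong w⁻ {apply u} {apply v} eq) ⟨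
    dot w⁻ (apply u) + u x * N  ≡⟨ inv u ⟨
    dot w⁺ (apply u)            ≡⟨ dot-cong w⁺ {apply u} {apply v} eq ⟩
    dot w⁺ (apply v)            ≡⟨ inv v ⟩
    dot w⁻ (apply v) + v x * N  ∎))
    where open ≡-Reasoning

total : (Fin 4 → ℕ) → ℕ
total = dot (λ _ → 1)

count-total : ∀ f t → total (λ y → count f y t) ≡ t
count-total f zero    = refl
count-total f (suc t) = ≡.trans (dot-+ (λ _ → 1) (indicator (f t)) (λ y → count f y t))
  (cong₂ _+_ (dot-indicator (λ _ → 1) (f t)) (count-total f t))

incidence-count : ∀ x y → count (h x) y 85 ≡ incidence y x
incidence-count 𝕒 𝕒 = refl
incidence-count 𝕒 𝕓 = refl
incidence-count 𝕒 𝕔 = refl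
incidence-count 𝕒 𝕕 = refl
incidence-count 𝕓 𝕒 = refl
incidence-count 𝕓 𝕓 = refl
incidence-count 𝕓 𝕔 = refl
incidence-count 𝕓 𝕕 = refl
incidence-count 𝕔 𝕒 = refl
incidence-count 𝕔 𝕓 = refl
incidence-count 𝕔 𝕔 = refl
incidence-count 𝕔 𝕕 = refl
incidence-count 𝕕 𝕒 = refl
incidence-count 𝕕 𝕓 = refl
incidence-count 𝕕 𝕔 = refl
incidence-count 𝕕 𝕕 = refl

-- Iterates of the morphism and their letter counts

-- The `n`-th iterate of the morphism on `𝕒`, repeated with period `85 ^ n`.
K : ℕ → ℕ → Fin 4
K zero    _ = 𝕒
K (suc n) t = h (K n (t / 85)) (t % 85)

K-block : ∀ n q {r} → r < 85 → K (suc n) (q * 85 + r) ≡ h (K n q) r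
K-block n q {r} r< = cong₂ (λ i j → h (K n i) j) quot rem
  where
  quot : (q * 85 + r) / 85 ≡ q
  quot = ≡.trans (+-distrib-/-∣ˡ r (divides-refl q)) (≡.trans (cong₂ _+_ (m*n/n≡m q 85) (m<n⇒m/n≡0 r<)) (+-identityʳ q))
  rem : (q * 85 + r) % 85 ≡ r
  rem = ≡.trans (cong (_% 85) (+-comm (q * 85) r)) (≡.trans ([m+kn]%n≡m%n r q 85) (m<n⇒m%n≡m r<))

-- The prefix is split at its last block boundary: complete blocks contribute through the incidence
-- matrix, the remainder is a prefix of a single image.
count-block : ∀ n q y {r} → r ≤ 85 →
  count (K (suc n)) y (q * 85 + r) ≡ apply (λ x → count (K n) x q) y + count (h (K n q)) y r
count-blocks : ∀ n q y → count (K (suc n)) y (q * 85) ≡ apply (λ x → count (K n) x q) y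

count-block n q y {r} r≤ = ≡.trans (count-+ (K (suc n)) y (q * 85) r)
  (cong₂ _+_ (count-blocks n q y) (count-cong y r (λ s<r → K-block n q (<-≤-trans s<r r≤))))

count-blocks n zero    y = sym (dot-* 0 (incidence y) (λ _ → 0))
count-blocks n (suc q) y = begin
  count (K (suc n)) y (suc q * 85)   ≡⟨ cong (count (K (suc n)) y) {suc q * 85} {q * 85 + 85} (+-comm 85 (q * 85)) ⟩
  count (K (suc n)) y (q * 85 + 85)  ≡⟨ count-block n q y ≤-refl ⟩
  apply Ψ y + count (h z) y 85       ≡⟨ +-comm (apply Ψ y) _ ⟩
  count (h z) y 85 + apply Ψ y       ≡⟨ cong (_+ apply Ψ y) (≡.trans (incidence-count z y) (sym (dot-indicator (incidence y) z))) ⟩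
  apply (indicator z) y + apply Ψ y  ≡⟨ dot-+ (incidence y) (indicator z) Ψ ⟨
  apply (λ x → count (K n) x (suc q)) y ∎
  where
  open ≡-Reasoning
  z = K n q
  Ψ : Fin 4 → ℕ
  Ψ x = count (K n) x q

-- Equality of the letter counts on the intervals from `i` to `j` and from `j` to `k`, written with
-- prefix counts and without subtraction.
AbelianSquareFree : (ℕ → Fin 4) → ℕ → Set
AbelianSquareFree f N = ∀ {i j k} → i < j → j < k → k ≤ N →
  ¬ (∀ y → count f y i + count f y k ≡ 2 * count f y j)

-- Summing the balance over all letters turns counts into lengths.
balanced-midpoint : ∀ f i j k → (∀ y → count f y i + count f y k ≡ 2 * count f y j) → i + k ≡ 2 * j
balanced-midpoint f i j k bal = begin
  i + k                        ≡⟨ cong₂ _+_ (count-total f i) (count-total f k) ⟨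
  total (Φ i) + total (Φ k)    ≡⟨ dot-+ (λ _ → 1) (Φ i) (Φ k) ⟨
  total (λ y → Φ i y + Φ k y)  ≡⟨ dot-cong (λ _ → 1) {λ y → Φ i y + Φ k y} {λ y → 2 * Φ j y} bal ⟩
  total (λ y → 2 * Φ j y)      ≡⟨ dot-* 2 (λ _ → 1) (Φ j) ⟩
  2 * total (Φ j)              ≡⟨ cong (2 *_) (count-total f j) ⟩
  2 * j                        ∎
  where
  open ≡-Reasoning
  Φ : ℕ → Fin 4 → ℕ
  Φ p y = count f y p

parikh-cutAt : ∀ r x y → parikh (cutAt r x) y ≡ count (h x) y r
parikh-cutAt r x 𝕒 = refl
parikh-cutAt r x 𝕓 = refl
parikh-cutAt r x 𝕔 = refl
parikh-cutAt r x 𝕕 = refl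

-- Over the integers, `A - B` and `s - t` both equal `q - p`.
exchange : ∀ {A B p q s t} → A + p ≡ B + q → p + s ≡ q + t → A + t ≡ B + s
exchange {A} {B} {p} {q} {s} {t} eq eq′ = +-cancelʳ-≡ q (A + t) (B + s) (begin
  A + t + q    ≡⟨ solve 3 (λ A t q → A :+ t :+ q := A :+ (q :+ t)) refl A t q ⟩
  A + (q + t)  ≡⟨ cong (A +_) eq′ ⟨
  A + (p + s)  ≡⟨ +-assoc A p s ⟨
  A + p + s    ≡⟨ cong (_+ s) eq ⟩
  B + q + s    ≡⟨ solve 3 (λ B q s → B :+ q :+ s := B :+ s :+ q) refl B q s ⟩
  B + s + q    ∎)
  where open ≡-Reasoning

-- Modulo `N` the complete blocks vanish, which leaves the congruence of loads tested by the finite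
-- check.
balanced-mod : ∀ N .{{_ : NonZero N}} {a b A B w₀ w₁ w₂} → A ≡ a * N → B ≡ b * N →
  A + (w₀ + w₂) ≡ B + 2 * w₁ → (w₀ % N + w₂ % N) % N ≡ (2 * (w₁ % N)) % N
balanced-mod N {a} {b} {A} {B} {w₀} {w₁} {w₂} refl refl eq = begin
  (w₀ % N + w₂ % N) % N    ≡⟨ %-distribˡ-+ w₀ w₂ N ⟨
  (w₀ + w₂) % N            ≡⟨ [m+kn]%n≡m%n (w₀ + w₂) a N ⟨
  (w₀ + w₂ + a * N) % N    ≡⟨ cong (_% N) (≡.trans (+-comm (w₀ + w₂) (a * N)) (≡.trans eq (+-comm (b * N) (2 * w₁)))) ⟩
  (2 * w₁ + b * N) % N     ≡⟨ [m+kn]%n≡m%n (2 * w₁) b N ⟩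
  (2 * w₁) % N             ≡⟨ %-distribˡ-* 2 w₁ N ⟩
  ((2 % N) * (w₁ % N)) % N ≡⟨ cong (λ z → ((2 % N) * z) % N) (m%n%n≡m%n w₁ N) ⟨
  ((2 % N) * (w₁ % N % N)) % N ≡⟨ %-distribˡ-* 2 (w₁ % N) N ⟨
  (2 * (w₁ % N)) % N       ∎
  where open ≡-Reasoning

-- Multiplying the midpoint equation by 43 isolates `r₁`, since 43 · 2 = 86 = 1 + 85.
halve-mod : ∀ {r₀ r₁ r₂} q₀ q₁ q₂ → r₁ < 85 →
  (r₀ + q₀ * 85) + (r₂ + q₂ * 85) ≡ 2 * (r₁ + q₁ * 85) → (43 * (r₀ + r₂)) % 85 ≡ r₁
halve-mod {r₀} {r₁} {r₂} q₀ q₁ q₂ r₁< eq = begin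
  (43 * (r₀ + r₂)) % 85                                    ≡⟨ [m+kn]%n≡m%n (43 * (r₀ + r₂)) (43 * (q₀ + q₂)) 85 ⟨
  (43 * (r₀ + r₂) + 43 * (q₀ + q₂) * 85) % 85              ≡⟨ cong (_% 85) (regroup 43 85) ⟩
  (43 * ((r₀ + q₀ * 85) + (r₂ + q₂ * 85))) % 85            ≡⟨ cong (λ z → (43 * z) % 85) eq ⟩
  (43 * (2 * (r₁ + q₁ * 85))) % 85                         ≡⟨ cong (_% 85) (sym (*-assoc 43 2 (r₁ + q₁ * 85))) ⟩
  ((1 + 85) * (r₁ + q₁ * 85)) % 85                         ≡⟨ cong (_% 85) (regroup′ 85) ⟩
  (r₁ + (q₁ + (r₁ + q₁ * 85)) * 85) % 85                   ≡⟨ [m+kn]%n≡m%n r₁ (q₁ + (r₁ + q₁ * 85)) 85 ⟩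
  r₁ % 85                                                  ≡⟨ m<n⇒m%n≡m r₁< ⟩
  r₁                                                       ∎
  where
  open ≡-Reasoning
  regroup : ∀ m n → m * (r₀ + r₂) + m * (q₀ + q₂) * n ≡ m * ((r₀ + q₀ * n) + (r₂ + q₂ * n))
  regroup m n = solve 6 (λ m n r₀ r₂ q₀ q₂ → m :* (r₀ :+ r₂) :+ m :* (q₀ :+ q₂) :* n
    := m :* ((r₀ :+ q₀ :* n) :+ (r₂ :+ q₂ :* n))) refl m n r₀ r₂ q₀ q₂
  regroup′ : ∀ n → (1 + n) * (r₁ + q₁ * n) ≡ r₁ + (q₁ + (r₁ + q₁ * n)) * n
  regroup′ n = solve 3 (λ n r q → (con 1 :+ n) :* (r :+ q :* n) := r :+ (q :+ (r :+ q :* n)) :* n) refl n r₁ q₁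

count-step : ∀ {k} (f : ℕ → Fin k) y q (ε : Fin 2) →
  count f y (q + toℕ ε) ≡ count f y q + toℕ ε * indicator (f q) y
count-step f y q zero       = ≡.trans (cong (count f y) (+-identityʳ q)) (sym (+-identityʳ _))
count-step f y q (suc zero) = ≡.trans (cong (count f y) (+-comm q 1))
  (≡.trans (+-comm (indicator (f q) y) _) (cong (count f y q +_) (sym (+-identityʳ _))))

-- Rounding up starts from a positive offset, so then `q * 85 < N * 85` and block `q` still ends
-- within the word.
round-up≤ : ∀ (ε : Fin 2) {r q N} → toℕ ε ≤ r → r + q * 85 ≤ N * 85 → q + toℕ ε ≤ N
round-up≤ zero {r} {q} {N} _ le = subst (_≤ N) (sym (+-identityʳ q)) (*-cancelʳ-≤ q N 85 (≤-trans (m≤n+m (q * 85) r) le))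
round-up≤ (suc zero) {r} {q} {N} 1≤r le = subst (_≤ N) (+-comm 1 q)
  (*-cancelʳ-< 85 q N (<-≤-trans (+-monoˡ-≤ (q * 85) 1≤r) le))

-- If `i` and `j` round to the same block boundary, their distances from it compare as `i` and `j`
-- do. This contradicts the last condition of `Resolves`.
offset-< : ∀ {i j e e′} → i < j → i / 85 + e ≡ j / 85 + e′ → i % 85 + 85 * e′ < j % 85 + 85 * e
offset-< {i} {j} {e} {e′} i<j eq = +-cancelʳ-< (Q * 85) (i % 85 + 85 * e′) (j % 85 + 85 * e) (begin-strict
  i % 85 + 85 * e′ + Q * 85             ≡⟨ regroup (i % 85) (i / 85) e e′ 85 ⟩
  i % 85 + i / 85 * 85 + 85 * (e + e′)  ≡⟨ cong (_+ 85 * (e + e′)) (m≡m%n+[m/n]*n i 85) ⟨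
  i + 85 * (e + e′)                     <⟨ +-monoˡ-< (85 * (e + e′)) i<j ⟩
  j + 85 * (e + e′)                     ≡⟨ cong₂ (λ a s → a + 85 * s) (m≡m%n+[m/n]*n j 85) (+-comm e e′) ⟩
  j % 85 + j / 85 * 85 + 85 * (e′ + e)  ≡⟨ regroup (j % 85) (j / 85) e′ e 85 ⟨
  j % 85 + 85 * e + (j / 85 + e′) * 85  ≡⟨ cong (λ P → j % 85 + 85 * e + P * 85) eq ⟨
  j % 85 + 85 * e + Q * 85              ∎)
  where
  open ≤-Reasoning
  Q = i / 85 + e
  regroup : ∀ r q e e′ N → r + N * e′ + (q + e) * N ≡ r + q * N + N * (e + e′)
  regroup = solve 5 (λ r q e e′ N → r :+ N :* e′ :+ (q :+ e) :* N := r :+ q :* N :+ N :* (e :+ e′)) refl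

toℕ≤1 : (ε : Fin 2) → toℕ ε ≤ 1
toℕ≤1 ε = Fin.toℕ≤pred[n] ε

-- Descent: the finite check rounds the three cuts of an abelian square to block boundaries, and
-- injectivity of the incidence matrix turns these into a balanced triple one level down. The order
-- of the rounded cuts decides how the contradiction arises.
K-abelianSquareFree : ∀ n → AbelianSquareFree (K n) (85 ^ n)
K-abelianSquareFree zero    i<j (s≤s j≤k) (s≤s k≤0) _ = n≮0 (<-≤-trans i<j (≤-trans j≤k k≤0))
K-abelianSquareFree (suc n) {i} {j} {k} i<j j<k k≤ bal = finish
  (resolvable (x i) (x j) (x k) {i % 85} {j % 85} {k % 85} (m%n<n i 85) (m%n<n j 85) (m%n<n k 85)
    (halve-mod {i % 85} {j % 85} {k % 85} (i / 85) (j / 85) (k / 85) (m%n<n j 85) lengths)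
    (balanced-mod 43435 {dot (quad 43 47 40 44) (λ z → Ψ i z + Ψ k z)} {dot (quad 43 47 40 44) (λ z → 2 * Ψ j z)}
      {w₀ = weight (π i)} {weight (π j)} {weight (π k)}
      (weight-apply (λ z → Ψ i z + Ψ k z)) (weight-apply (λ z → 2 * Ψ j z)) weights))
  where
  open ≡-Reasoning
  x : ℕ → Fin 4
  x p = K n (p / 85)
  Ψ π : ℕ → Fin 4 → ℕ
  Ψ p z = count (K n) z (p / 85)
  π p y = count (h (x p)) y (p % 85)

  split : ∀ p y → count (K (suc n)) y p ≡ apply (Ψ p) y + π p y
  split p y = ≡.trans (cong (count (K (suc n)) y) (≡.trans (m≡m%n+[m/n]*n p 85) (+-comm (p % 85) _)))
                    (count-block n (p / 85) y (<⇒≤ (m%n<n p 85)))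

  balance : ∀ y → apply (λ z → Ψ i z + Ψ k z) y + (π i y + π k y) ≡ apply (λ z → 2 * Ψ j z) y + 2 * π j y
  balance y = begin
    apply (λ z → Ψ i z + Ψ k z) y + (π i y + π k y)
      ≡⟨ cong (_+ (π i y + π k y)) (dot-+ (incidence y) (Ψ i) (Ψ k)) ⟩
    apply (Ψ i) y + apply (Ψ k) y + (π i y + π k y)
      ≡⟨ solve 4 (λ A B p q → A :+ B :+ (p :+ q) := (A :+ p) :+ (B :+ q)) refl (apply (Ψ i) y) (apply (Ψ k) y) (π i y) (π k y) ⟩
    (apply (Ψ i) y + π i y) + (apply (Ψ k) y + π k y)
      ≡⟨ cong₂ _+_ (split i y) (split k y) ⟨
    count (K (suc n)) y i + count (K (suc n)) y k
      ≡⟨ bal y ⟩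
    2 * count (K (suc n)) y j
      ≡⟨ cong (2 *_) (split j y) ⟩
    2 * (apply (Ψ j) y + π j y)
      ≡⟨ *-distribˡ-+ 2 (apply (Ψ j) y) (π j y) ⟩
    2 * apply (Ψ j) y + 2 * π j y
      ≡⟨ cong (_+ 2 * π j y) (dot-* 2 (incidence y) (Ψ j)) ⟨
    apply (λ z → 2 * Ψ j z) y + 2 * π j y ∎

  dot-balance : ∀ w → dot w (apply (λ z → Ψ i z + Ψ k z)) + (dot w (π i) + dot w (π k))
                    ≡ dot w (apply (λ z → 2 * Ψ j z)) + 2 * dot w (π j)
  dot-balance w = begin
    dot w U + (dot w (π i) + dot w (π k))     ≡⟨ cong (dot w U +_) (dot-+ w (π i) (π k)) ⟨
    dot w U + dot w (λ y → π i y + π k y)     ≡⟨ dot-+ w U (λ y → π i y + π k y) ⟨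
    dot w (λ y → U y + (π i y + π k y))       ≡⟨ dot-cong w {λ y → U y + (π i y + π k y)} {λ y → V y + 2 * π j y} balance ⟩
    dot w (λ y → V y + 2 * π j y)             ≡⟨ dot-+ w V (λ y → 2 * π j y) ⟩
    dot w V + dot w (λ y → 2 * π j y)         ≡⟨ cong (dot w V +_) (dot-* 2 w (π j)) ⟩
    dot w V + 2 * dot w (π j)                 ∎
    where
    U V : Fin 4 → ℕ
    U = apply (λ z → Ψ i z + Ψ k z)
    V = apply (λ z → 2 * Ψ j z)

  weights = dot-balance (quad 1 30176 19636 39101)

  lengths : (i % 85 + i / 85 * 85) + (k % 85 + k / 85 * 85) ≡ 2 * (j % 85 + j / 85 * 85)
  lengths = ≡.trans (sym (cong₂ _+_ (m≡m%n+[m/n]*n i 85) (m≡m%n+[m/n]*n k 85)))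
    (≡.trans (balanced-midpoint (K (suc n)) i j k bal) (cong (2 *_) (m≡m%n+[m/n]*n j 85)))

  finish : Resolvable (cutAt (i % 85) (x i)) (cutAt (j % 85) (x j)) (cutAt (k % 85) (x k)) → ⊥
  finish (ε₀ , ε₁ , ε₂ , ε₀≤ , ε₁≤ , ε₂≤ , resolved , nondegenerate) = compareQ (<-cmp Q₀ Q₁)
    where
    e₀ = toℕ ε₀
    e₁ = toℕ ε₁
    e₂ = toℕ ε₂
    Q₀ = i / 85 + e₀
    Q₁ = j / 85 + e₁
    Q₂ = k / 85 + e₂

    -- The letters gained by rounding up: `s` at the middle cut, counted twice, and `t` at the outer
    -- cuts.
    s t : Fin 4 → ℕ
    s z = 2 * (e₁ * indicator (x j) z)
    t z = e₀ * indicator (x i) z + e₂ * indicator (x k) z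

    apply-s : ∀ y → apply s y ≡ 2 * (e₁ * incidence y (x j))
    apply-s y = ≡.trans (dot-* 2 (incidence y) (λ z → e₁ * indicator (x j) z))
      (cong (2 *_) (≡.trans (dot-* e₁ (incidence y) (indicator (x j))) (cong (e₁ *_) (dot-indicator (incidence y) (x j)))))

    apply-t : ∀ y → apply t y ≡ e₀ * incidence y (x i) + e₂ * incidence y (x k)
    apply-t y = ≡.trans (dot-+ (incidence y) (λ z → e₀ * indicator (x i) z) (λ z → e₂ * indicator (x k) z)) (cong₂ _+_
      (≡.trans (dot-* e₀ (incidence y) (indicator (x i))) (cong (e₀ *_) (dot-indicator (incidence y) (x i))))
      (≡.trans (dot-* e₂ (incidence y) (indicator (x k))) (cong (e₂ *_) (dot-indicator (incidence y) (x k)))))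

    resolved′ : ∀ y → (π i y + π k y) + apply s y ≡ 2 * π j y + apply t y
    resolved′ y = begin
      (π i y + π k y) + apply s y
        ≡⟨ cong₂ _+_ (cong₂ _+_ (sym (parikh-cutAt (i % 85) (x i) y)) (sym (parikh-cutAt (k % 85) (x k) y))) (apply-s y) ⟩
      (parikh (cutAt (i % 85) (x i)) y + parikh (cutAt (k % 85) (x k)) y) + 2 * (e₁ * incidence y (x j))
        ≡⟨ resolved y ⟩
      2 * parikh (cutAt (j % 85) (x j)) y + (e₀ * incidence y (x i) + e₂ * incidence y (x k))
        ≡⟨ cong₂ _+_ (cong (2 *_) (parikh-cutAt (j % 85) (x j) y)) (sym (apply-t y)) ⟩
      2 * π j y + apply t y ∎

    -- The balance of the partial blocks is traded for that of the rounded letters. Both sides are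
    -- then images under the incidence matrix, which is injective.
    lifted : ∀ z → (Ψ i z + Ψ k z) + t z ≡ 2 * Ψ j z + s z
    lifted = apply-injective λ y → begin
      apply (λ z → Ψ i z + Ψ k z + t z) y        ≡⟨ dot-+ (incidence y) (λ z → Ψ i z + Ψ k z) t ⟩
      apply (λ z → Ψ i z + Ψ k z) y + apply t y  ≡⟨ exchange {apply (λ z → Ψ i z + Ψ k z) y} {apply (λ z → 2 * Ψ j z) y}
                                                             {π i y + π k y} {2 * π j y} (balance y) (resolved′ y) ⟩
      apply (λ z → 2 * Ψ j z) y + apply s y      ≡⟨ dot-+ (incidence y) (λ z → 2 * Ψ j z) s ⟨
      apply (λ z → 2 * Ψ j z + s z) y            ∎

    balanced : ∀ z → count (K n) z Q₀ + count (K n) z Q₂ ≡ 2 * count (K n) z Q₁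
    balanced z = begin
      count (K n) z Q₀ + count (K n) z Q₂
        ≡⟨ cong₂ _+_ (count-step (K n) z (i / 85) ε₀) (count-step (K n) z (k / 85) ε₂) ⟩
      (Ψ i z + e₀ * indicator (x i) z) + (Ψ k z + e₂ * indicator (x k) z)
        ≡⟨ solve 4 (λ A B p q → (A :+ p) :+ (B :+ q) := A :+ B :+ (p :+ q)) refl (Ψ i z) (Ψ k z) (e₀ * indicator (x i) z) _ ⟩
      Ψ i z + Ψ k z + t z
        ≡⟨ lifted z ⟩
      2 * Ψ j z + 2 * (e₁ * indicator (x j) z)
        ≡⟨ *-distribˡ-+ 2 (Ψ j z) _ ⟨
      2 * (Ψ j z + e₁ * indicator (x j) z)
        ≡⟨ cong (2 *_) (count-step (K n) z (j / 85) ε₁) ⟨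
      2 * count (K n) z Q₁ ∎

    midpoint′ : Q₀ + Q₂ ≡ Q₁ + Q₁
    midpoint′ = ≡.trans (balanced-midpoint (K n) Q₀ Q₁ Q₂ balanced) (cong (Q₁ +_) (+-identityʳ Q₁))

    Q₂≤ : Q₂ ≤ 85 ^ n
    Q₂≤ = round-up≤ ε₂ ε₂≤ (subst₂ _≤_ (m≡m%n+[m/n]*n k 85) (*-comm 85 (85 ^ n)) k≤)

    i/85≤j/85 : i / 85 ≤ j / 85
    i/85≤j/85 = /-monoˡ-≤ 85 (<⇒≤ i<j)
    j/85≤k/85 : j / 85 ≤ k / 85
    j/85≤k/85 = /-monoˡ-≤ 85 (<⇒≤ j<k)

    same-letter : ∀ {p q e e′} → p / 85 + e ≡ q / 85 + e′ → e ≡ e′ → x p ≡ x q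
    same-letter {p} {q} {e} eq refl = cong (K n) (+-cancelʳ-≡ e (p / 85) (q / 85) eq)

    -- The midpoint equation makes all three boundaries coincide, the case that `nondegenerate`
    -- excludes.
    degenerate : Q₀ ≡ Q₁ → ⊥
    degenerate Q₀≡Q₁ = <-irrefl refl (<-≤-trans (offset-< {i} {j} {e₀} {e₁} i<j Q₀≡Q₁)
      (nondegenerate (same-letter {i} {j} Q₀≡Q₁) (same-letter {j} {k} Q₁≡Q₂)))
      where
      Q₁≡Q₂ : Q₁ ≡ Q₂
      Q₁≡Q₂ = sym (+-cancelˡ-≡ Q₁ Q₂ Q₁ (≡.trans (cong (_+ Q₂) (sym Q₀≡Q₁)) midpoint′))

    compareQ : Tri (Q₀ < Q₁) (Q₀ ≡ Q₁) (Q₁ < Q₀) → ⊥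
    compareQ (tri< Q₀<Q₁ _ _) = K-abelianSquareFree n Q₀<Q₁ Q₁<Q₂ Q₂≤ balanced
      where
      Q₁<Q₂ : Q₁ < Q₂
      Q₁<Q₂ = +-cancelˡ-< Q₁ Q₁ Q₂ (subst (_< Q₁ + Q₂) midpoint′ (+-monoˡ-< Q₂ Q₀<Q₁))
    compareQ (tri≈ _ Q₀≡Q₁ _) = degenerate Q₀≡Q₁
    -- The order of the boundaries is reversed. As `j / 85 ≤ k / 85`, the inequality `Q₂ < Q₁` needs
    -- `e₁` positive; as `i / 85 ≤ j / 85`, the inequality `Q₁ < Q₀` needs `e₀ > e₁`. So `e₀` would
    -- be at least 2.
    compareQ (tri> _ _ Q₁<Q₀) = <-irrefl refl (≤-trans (s≤s 0<e₁) (≤-trans e₁<e₀ (toℕ≤1 ε₀)))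
      where
      Q₂<Q₁ : Q₂ < Q₁
      Q₂<Q₁ = +-cancelˡ-< Q₁ Q₂ Q₁ (subst (Q₁ + Q₂ <_) midpoint′ (+-monoˡ-< Q₂ Q₁<Q₀))
      0<e₁ : 0 < e₁
      0<e₁ = +-cancelˡ-< (j / 85) 0 e₁ (≤-<-trans (≤-reflexive (+-identityʳ (j / 85))) (≤-<-trans (≤-trans j/85≤k/85 (m≤m+n _ e₂)) Q₂<Q₁))
      e₁<e₀ : e₁ < e₀
      e₁<e₀ = +-cancelˡ-< (j / 85) e₁ e₀ (<-≤-trans Q₁<Q₀ (+-monoˡ-≤ e₀ i/85≤j/85))

-- The colouring of a single edge

indicator-≡ : ∀ {k} {i j : Fin k} → i ≡ j → indicator i j ≡ 1
indicator-≡ {i = i} {j} eq = cong (if_then 1 else 0) (dec-true (i Fin.≟ j) eq)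

indicator-≢ : ∀ {k} {i j : Fin k} → i ≢ j → indicator i j ≡ 0
indicator-≢ {i = i} {j} neq = cong (if_then 1 else 0) (dec-false (i Fin.≟ j) neq)

count-mono : ∀ {k} (f : ℕ → Fin k) y {i j} → i ≤ j → count f y i ≤ count f y j
count-mono f y {i} {j} i≤j = subst (λ t → count f y i ≤ count f y t) (m+[n∸m]≡n i≤j)
  (≤-trans (m≤m+n _ _) (≤-reflexive (sym (count-+ f y i (j ∸ i)))))

count-present : ∀ {k} (f : ℕ → Fin k) y {i s j} → i ≤ s → s < j → f s ≡ y → count f y i < count f y j
count-present f y {i} {s} {j} i≤s s<j eq = ≤-trans (s≤s (count-mono f y i≤s))
  (≤-trans (≤-reflexive (cong (_+ count f y s) (sym (indicator-≡ eq)))) (count-mono f y s<j))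

count-none : ∀ {k} (f : ℕ → Fin k) y t → (∀ {s} → s < t → f s ≢ y) → count f y t ≡ 0
count-none f y zero    none = refl
count-none f y (suc t) none = cong₂ _+_ (indicator-≢ (none ≤-refl)) (count-none f y t (none ∘ m<n⇒m<1+n))

count-absent : ∀ {k} (f : ℕ → Fin k) y {i j} → i ≤ j → (∀ {s} → i ≤ s → s < j → f s ≢ y) → count f y j ≡ count f y i
count-absent f y {i} {j} i≤j none = begin
  count f y j                                              ≡⟨ cong (count f y) (m+[n∸m]≡n i≤j) ⟨
  count f y (i + (j ∸ i))                                  ≡⟨ count-+ f y i (j ∸ i) ⟩
  count f y i + count (λ s → f (i + s)) y (j ∸ i)          ≡⟨ cong (count f y i +_) (count-none _ y (j ∸ i) λ {s} s< →
                                                               none (m≤m+n i s) (subst (i + s <_) (m+[n∸m]≡n i≤j) (+-monoʳ-< i s<))) ⟩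
  count f y i + 0                                          ≡⟨ +-identityʳ _ ⟩
  count f y i                                              ∎
  where open ≡-Reasoning

count-injective : ∀ {k l} (g : Fin k → Fin l) → (∀ {i j} → g i ≡ g j → i ≡ j) →
  ∀ (f : ℕ → Fin k) y t → count (g ∘ f) (g y) t ≡ count f y t
count-injective g inj f y zero    = refl
count-injective g inj f y (suc t) = cong₂ _+_ indicator-g (count-injective g inj f y t)
  where
  indicator-g : indicator (g (f t)) (g y) ≡ indicator (f t) y
  indicator-g with f t Fin.≟ y
  ... | yes eq = indicator-≡ (cong g eq)
  ... | no neq = indicator-≢ (neq ∘ inj)

-- Colours 4 to 7. Colour 0 is kept for original vertices and 1 to 3 for the letters shared by all
-- regions.
mark : ℕ → Fin 8
mark j = suc (suc (suc (suc (j mod 4))))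

tint : ℕ → Fin 4 → Fin 8
tint j 𝕒 = mark j
tint j 𝕓 = # 1
tint j 𝕔 = # 2
tint j 𝕕 = # 3

mark-injective : ∀ {i j} → i < 4 → j < 4 → mark i ≡ mark j → i ≡ j
mark-injective {i} {j} i<4 j<4 eq = begin
  i                ≡⟨ m<n⇒m%n≡m i<4 ⟨
  i % 4            ≡⟨ Fin.toℕ-fromℕ< (m%n<n i 4) ⟨
  toℕ (i mod 4)    ≡⟨ cong toℕ (strip eq) ⟩
  toℕ (j mod 4)    ≡⟨ Fin.toℕ-fromℕ< (m%n<n j 4) ⟩
  j % 4            ≡⟨ m<n⇒m%n≡m j<4 ⟩
  j                ∎
  where
  open ≡-Reasoning
  strip : ∀ {a b : Fin 4} → Fin.suc (suc (suc (suc a))) ≡ suc (suc (suc (suc b))) → a ≡ b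
  strip refl = refl

tint-injective : ∀ j {x y} → tint j x ≡ tint j y → x ≡ y
tint-injective j {𝕒} {𝕒} _  = refl
tint-injective j {𝕒} {𝕓} ()
tint-injective j {𝕒} {𝕔} ()
tint-injective j {𝕒} {𝕕} ()
tint-injective j {𝕓} {𝕒} ()
tint-injective j {𝕓} {𝕓} _  = refl
tint-injective j {𝕓} {𝕔} ()
tint-injective j {𝕓} {𝕕} ()
tint-injective j {𝕔} {𝕒} ()
tint-injective j {𝕔} {𝕓} ()
tint-injective j {𝕔} {𝕔} _  = refl
tint-injective j {𝕔} {𝕕} ()
tint-injective j {𝕕} {𝕒} ()
tint-injective j {𝕕} {𝕓} ()
tint-injective j {𝕕} {𝕔} ()
tint-injective j {𝕕} {𝕕} _  = refl

tint-mark : ∀ i {j} y → tint i y ≡ mark j → mark i ≡ mark j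
tint-mark _ 𝕒 eq = eq
tint-mark _ 𝕓 ()
tint-mark _ 𝕔 ()
tint-mark _ 𝕕 ()

tint-nonzero : ∀ j y → tint j y ≢ zero
tint-nonzero j 𝕒 ()
tint-nonzero j 𝕓 ()
tint-nonzero j 𝕔 ()
tint-nonzero j 𝕕 ()

-- Regions of an edge

size : ℕ → ℕ
size e = 85 ^ e

size≢0 : ∀ e → NonZero (size e)
size≢0 e = m^n≢0 85 e

region : ℕ → ℕ → ℕ
region e t = _/_ t (size e) {{size≢0 e}}

edgeColour : ℕ → ℕ → Fin 8
edgeColour e t = tint (region e t) (K e (_%_ t (size e) {{size≢0 e}}))

region-block : ∀ e j {s} → s < size e → region e (j * size e + s) ≡ j
region-block e j {s} s< = ≡.trans (+-distrib-/-∣ˡ s (divides-refl j))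
  (≡.trans (cong₂ _+_ (m*n/n≡m j (size e)) (m<n⇒m/n≡0 s<)) (+-identityʳ j))
  where instance _ = size≢0 e

edgeColour-block : ∀ e j {s} → s < size e → edgeColour e (j * size e + s) ≡ tint j (K e s)
edgeColour-block e j {s} s< = cong₂ (λ i r → tint i (K e r)) (region-block e j s<)
  (≡.trans (cong (_% size e) (+-comm (j * size e) s)) (≡.trans ([m+kn]%n≡m%n s j (size e)) (m<n⇒m%n≡m s<)))
  where instance _ = size≢0 e

region-mono : ∀ e {s t} → s ≤ t → region e s ≤ region e t
region-mono e = /-monoˡ-≤ (size e)
  where instance _ = size≢0 e

region-suc : ∀ e t → region e (suc t) ≤ suc (region e t)
region-suc e t = ≤-trans (/-monoˡ-≤ (size e) (+-monoˡ-≤ t (>-nonZero⁻¹ (size e))))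
  (≤-reflexive (≡.trans (+-distrib-/-∣ˡ t (∣-refl {size e}))
    (cong (_+ region e t) (n/n≡1 (size e)))))
  where
  instance _ = size≢0 e

region-< : ∀ e {t} j → t < j * size e → region e t < j
region-< e j = m<n*o⇒m/o<n
  where instance _ = size≢0 e

region-≥ : ∀ e {t} j → j * size e ≤ t → j ≤ region e t
region-≥ e {t} j le = ≤-trans (≤-reflexive (sym (m*n/n≡m j (size e)))) (/-monoˡ-≤ (size e) le)
  where instance _ = size≢0 e

region-*-≤ : ∀ e t → region e t * size e ≤ t
region-*-≤ e t = m/n*n≤m t (size e)
  where instance _ = size≢0 e

<-region-* : ∀ e t → t < suc (region e t) * size e
<-region-* e t = begin-strict
  t                                      ≡⟨ m≡m%n+[m/n]*n t (size e) ⟩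
  t % size e + region e t * size e       <⟨ +-monoˡ-< (region e t * size e) (m%n<n t (size e)) ⟩
  size e + region e t * size e           ∎
  where
  open ≤-Reasoning
  instance _ = size≢0 e

edgeColour-nonzero : ∀ e t → edgeColour e t ≢ zero
edgeColour-nonzero e t = tint-nonzero (region e t) (K e (_%_ t (size e) {{size≢0 e}}))

edgeColour-mark : ∀ e {t j} → t < 4 * size e → j < 4 → edgeColour e t ≡ mark j → region e t ≡ j
edgeColour-mark e {t} {j} t< j<4 eq = mark-injective (region-< e 4 t<) j<4 (tint-mark (region e t) {j} (K e _) eq)

-- The image of `𝕒` begins and ends with `𝕒`, and so do all iterates. With `K-last` this puts a mark
-- at both ends of every region.
K-first : ∀ n → K n 0 ≡ 𝕒
K-first zero    = refl
K-first (suc n) = cong (λ x → h x 0) (K-first n)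

K-last : ∀ n {t} → suc t ≡ size n → K n t ≡ 𝕒
K-last zero    _ = refl
K-last (suc n) {t} eq = ≡.trans (cong (K (suc n)) t≡) (≡.trans (K-block n (size n ∸ 1) (≤-refl {85})) (cong (λ x → h x 84) (K-last n pred-size)))
  where
  pred-size : suc (size n ∸ 1) ≡ size n
  pred-size = m+[n∸m]≡n (>-nonZero⁻¹ (size n) {{size≢0 n}})
  t≡ : t ≡ (size n ∸ 1) * 85 + 84
  t≡ = suc-injective (≡.trans eq (≡.trans (cong (85 *_) (sym pred-size))
    (solve 1 (λ q → con 85 :* (con 1 :+ q) := con 1 :+ (q :* con 85 :+ con 84)) refl (size n ∸ 1))))

-- Marks of a large region against all smaller ones

-- The total length of the regions with one fixed number on the edges numbered below `n`.
geometric : ℕ → ℕ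
geometric zero    = 0
geometric (suc n) = size n + geometric n

geometric≤size : ∀ n → geometric n ≤ size n
geometric≤size zero    = z≤n
geometric≤size (suc n) = ≤-trans (+-monoʳ-≤ (size n) (geometric≤size n))
  (≤-trans (≤-reflexive (cong (size n +_) (sym (+-identityʳ (size n))))) (*-monoˡ-≤ (size n) {2} {85} (s≤s (s≤s z≤n))))

18≤incidence-row : ∀ x → 18 ≤ incidence 𝕒 x
18≤incidence-row 𝕒 = m≤m+n 18 1
18≤incidence-row 𝕓 = m≤m+n 18 0
18≤incidence-row 𝕔 = m≤m+n 18 9
18≤incidence-row 𝕕 = m≤m+n 18 3

dot-lower : ∀ {c w} u → (∀ x → c ≤ w x) → c * total u ≤ dot w u
dot-lower {c} {w} u c≤ = ≤-trans
  (≤-reflexive (solve 5 (λ c p q r s → c :* (con 1 :* p :+ con 1 :* q :+ con 1 :* r :+ con 1 :* s)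
    := c :* p :+ c :* q :+ c :* r :+ c :* s) refl c (u 𝕒) (u 𝕓) (u 𝕔) (u 𝕕)))
  (+-mono-≤ (+-mono-≤ (+-mono-≤ (*-monoˡ-≤ (u 𝕒) (c≤ 𝕒)) (*-monoˡ-≤ (u 𝕓) (c≤ 𝕓))) (*-monoˡ-≤ (u 𝕔) (c≤ 𝕔))) (*-monoˡ-≤ (u 𝕕) (c≤ 𝕕)))

-- Each image has at least 18 letters `𝕒`, which gives at least 18 · 85^n marks on level `n + 1`,
-- while the smaller regions have total length at most 2 · 85^n.
geometric<count : ∀ n → geometric n < count (K n) 𝕒 (size n)
geometric<count zero    = s≤s z≤n
geometric<count (suc n) = begin-strict
  size n + geometric n                          ≤⟨ +-monoʳ-≤ (size n) (geometric≤size n) ⟩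
  size n + size n                               ≡⟨ cong (size n +_) (+-identityʳ (size n)) ⟨
  2 * size n                                    <⟨ *-monoˡ-< (size n) {{size≢0 n}} {2} {18} (s≤s (s≤s (s≤s z≤n))) ⟩
  18 * size n                                   ≡⟨ cong (18 *_) (count-total (K n) (size n)) ⟨
  18 * total (λ x → count (K n) x (size n))     ≤⟨ dot-lower (λ x → count (K n) x (size n)) 18≤incidence-row ⟩
  apply (λ x → count (K n) x (size n)) 𝕒        ≡⟨ count-blocks n (size n) 𝕒 ⟨
  count (K (suc n)) 𝕒 (size n * 85)             ≡⟨ cong (count (K (suc n)) 𝕒) (*-comm (size n) 85) ⟩
  count (K (suc n)) 𝕒 (85 * size n)             ∎
  where open ≤-Reasoning

-- Abelian squares on a single edge

-- If the first and last positions lie in different regions, a mark at a region boundary occurs in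
-- one half only. Otherwise the colouring is a renaming of Keränen's word.
edge-squareFree : ∀ e {i j k} → i < j → j < k → k ≤ 4 * size e →
  ¬ (∀ y → count (edgeColour e) y i + count (edgeColour e) y k ≡ 2 * count (edgeColour e) y j)
edge-squareFree e {i} {j} {suc k} i<j j<k k≤ bal with m≤n⇒m<n∨m≡n (region-mono e (≤-trans (<⇒≤ i<j) (s≤s⁻¹ j<k)))
... | inj₁ a<b = across (suc a * N ≤? j)
  where
  f = edgeColour e
  N = size e
  a = region e i
  b = region e k
  -- The last position of region `a`, which carries mark `a`.
  p = a * N + (N ∸ 1)
  suc-p : suc p ≡ suc a * N
  suc-p = ≡.trans (sym (+-suc (a * N) (N ∸ 1)))
    (≡.trans (cong (a * N +_) (m+[n∸m]≡n (>-nonZero⁻¹ N {{size≢0 e}}))) (+-comm (a * N) N))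
  next≤ : suc a * N ≤ b * N
  next≤ = *-monoˡ-≤ N a<b
  b<4 : b < 4
  b<4 = region-< e 4 k≤
  colour-p : f p ≡ mark a
  colour-p = ≡.trans (edgeColour-block e a (≤-reflexive (m+[n∸m]≡n (>-nonZero⁻¹ N {{size≢0 e}}))))
    (cong (tint a) (K-last e (m+[n∸m]≡n (>-nonZero⁻¹ N {{size≢0 e}}))))
  colour-b : f (b * N) ≡ mark b
  colour-b = ≡.trans (cong f (sym (+-identityʳ (b * N))))
    (≡.trans (edgeColour-block e b (>-nonZero⁻¹ N {{size≢0 e}})) (cong (tint b) (K-first e)))
  across : Dec (suc a * N ≤ j) → ⊥
  -- The first half contains `p`, while the second half begins beyond region `a` and has no mark
  -- `a`.
  across (yes a<j) = <-irrefl count-i≡ (count-present f (mark a) i≤p (subst (_≤ j) (sym suc-p) a<j) colour-p)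
    where
    i≤p : i ≤ p
    i≤p = s≤s⁻¹ (subst (i <_) (sym suc-p) (<-region-* e i))
    count-k≡ : count f (mark a) (suc k) ≡ count f (mark a) j
    count-k≡ = count-absent f (mark a) (<⇒≤ j<k) λ {s} j≤s s<k eq → <-irrefl
      (sym (edgeColour-mark e (<-≤-trans s<k k≤) (<-trans a<b b<4) eq)) (region-≥ e (suc a) (≤-trans a<j j≤s))
    count-i≡ : count f (mark a) i ≡ count f (mark a) j
    count-i≡ = +-cancelʳ-≡ (count f (mark a) j) _ _ (≡.trans (cong (count f (mark a) i +_) (sym count-k≡))
      (≡.trans (bal (mark a)) (cong (count f (mark a) j +_) (+-identityʳ _))))
  -- The first half stays inside region `a`, while the second half contains the first position of
  -- region `b`, which carries mark `b`.
  across (no a≮j) = <-irrefl (sym count-k≡) (count-present f (mark b) (≤-trans (<⇒≤ (≰⇒> a≮j)) next≤) (s≤s (region-*-≤ e k)) colour-b)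
    where
    count-i≡ : count f (mark b) j ≡ count f (mark b) i
    count-i≡ = count-absent f (mark b) (<⇒≤ i<j) λ {s} i≤s s<j eq → <-irrefl
      (edgeColour-mark e (<-≤-trans s<j (≤-trans (<⇒≤ j<k) k≤)) b<4 eq) (<-≤-trans (region-< e (suc a) (<-trans s<j (≰⇒> a≮j))) a<b)
    count-k≡ : count f (mark b) (suc k) ≡ count f (mark b) j
    count-k≡ = +-cancelˡ-≡ (count f (mark b) j) _ _ (≡.trans (cong (_+ count f (mark b) (suc k)) count-i≡)
      (≡.trans (bal (mark b)) (cong (count f (mark b) j +_) (+-identityʳ _))))
... | inj₂ a≡b = K-abelianSquareFree e (∸-monoˡ-< i<j i≥) (∸-monoˡ-< j<k j≥) k′≤ within
  where
  f = edgeColour e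
  N = size e
  a = region e i
  i≥ : a * N ≤ i
  i≥ = region-*-≤ e i
  j≥ : a * N ≤ j
  j≥ = ≤-trans i≥ (<⇒≤ i<j)
  k≥ : a * N ≤ suc k
  k≥ = ≤-trans j≥ (<⇒≤ j<k)
  k′≤ : suc k ∸ a * N ≤ N
  k′≤ = m≤n+o⇒m∸n≤o (suc k) (a * N) (≤-trans (subst (λ r → k < suc r * N) (sym a≡b) (<-region-* e k)) (≤-reflexive (+-comm N (a * N))))
  shifted : ∀ y {t} → a * N ≤ t → t ∸ a * N ≤ N → count f (tint a y) t ≡ count f (tint a y) (a * N) + count (K e) y (t ∸ a * N)
  shifted y {t} t≥ t≤ = begin
    count f (tint a y) t                        ≡⟨ cong (count f (tint a y)) (m+[n∸m]≡n t≥) ⟨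
    count f (tint a y) (a * N + (t ∸ a * N))    ≡⟨ count-+ f (tint a y) (a * N) (t ∸ a * N) ⟩
    C + count (λ s → f (a * N + s)) (tint a y) (t ∸ a * N)
      ≡⟨ cong (C +_) (count-cong (tint a y) (t ∸ a * N) (λ s< → edgeColour-block e a (<-≤-trans s< t≤))) ⟩
    C + count (tint a ∘ K e) (tint a y) (t ∸ a * N)
      ≡⟨ cong (C +_) (count-injective (tint a) (tint-injective a) (K e) y (t ∸ a * N)) ⟩
    C + count (K e) y (t ∸ a * N) ∎
    where
    open ≡-Reasoning
    C = count f (tint a y) (a * N)
  within : ∀ y → count (K e) y (i ∸ a * N) + count (K e) y (suc k ∸ a * N) ≡ 2 * count (K e) y (j ∸ a * N)
  within y = +-cancelˡ-≡ (2 * C) _ _ (begin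
    2 * C + (X i + X (suc k))                           ≡⟨ solve 3 (λ C p q → con 2 :* C :+ (p :+ q) := (C :+ p) :+ (C :+ q)) refl C (X i) (X (suc k)) ⟩
    (C + X i) + (C + X (suc k))                         ≡⟨ cong₂ _+_ (shifted y i≥ (≤-trans (∸-monoˡ-≤ (a * N) (<⇒≤ (<-trans i<j j<k))) k′≤)) (shifted y k≥ k′≤) ⟨
    count f (tint a y) i + count f (tint a y) (suc k)   ≡⟨ bal (tint a y) ⟩
    2 * count f (tint a y) j                            ≡⟨ cong (2 *_) (shifted y j≥ (≤-trans (∸-monoˡ-≤ (a * N) (<⇒≤ j<k)) k′≤)) ⟩
    2 * (C + X j)                                       ≡⟨ *-distribˡ-+ 2 C (X j) ⟩
    2 * C + 2 * X j                                     ∎)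
    where
    open ≡-Reasoning
    C = count f (tint a y) (a * N)
    X : ℕ → ℕ
    X t = count (K e) y (t ∸ a * N)

-- Lists

module _ {A : Set} where

  unique-⊆-length : ∀ {xs ys : List A} → Unique xs → (∀ {v} → v ∈ xs → v ∈ ys) → length xs ≤ length ys
  unique-⊆-length [] _ = z≤n
  unique-⊆-length {x ∷ xs} (x∉ ∷ unique) sub with as , bs , refl ← ∈-∃++ (sub (here refl)) =
    ≤-trans (s≤s (unique-⊆-length unique sub′)) (≤-reflexive (sym (length-++-sucʳ as x bs)))
    where
    sub′ : ∀ {v} → v ∈ xs → v ∈ as ++ bs
    sub′ v∈ with ∈-++⁻ as (sub (there v∈))
    ... | inj₁ v∈as          = ∈-++⁺ˡ v∈as
    ... | inj₂ (here refl)   = ⊥-elim (All.lookup x∉ v∈ refl)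
    ... | inj₂ (there v∈bs)  = ∈-++⁺ʳ as v∈bs

  unique-++⁻ : ∀ xs {ys : List A} → Unique (xs ++ ys) → Unique xs × Unique ys × Disjoint xs ys
  unique-++⁻ []       unique = [] , unique , λ ()
  unique-++⁻ (x ∷ xs) (x∉ ∷ unique) with uxs , uys , disjoint ← unique-++⁻ xs unique =
    (All.tabulate (λ v∈ → All.lookup x∉ (∈-++⁺ˡ v∈)) ∷ uxs) , uys , λ
      { (here refl , v∈ys) → All.lookup x∉ (∈-++⁺ʳ xs v∈ys) refl
      ; (there v∈xs , v∈ys) → disjoint (v∈xs , v∈ys) }

  map-≡-++ : ∀ {B : Set} (f : A → B) zs {us vs} → map f zs ≡ us ++ vs →
    ∃₂ λ xs ys → zs ≡ xs ++ ys × map f xs ≡ us × map f ys ≡ vs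
  map-≡-++ f zs {[]} eq = [] , zs , refl , refl , eq
  map-≡-++ f (z ∷ zs) {u ∷ us} eq with fz≡u , eq′ ← ∷-injective eq
                                   with xs , ys , refl , eq₁ , eq₂ ← map-≡-++ f zs {us} eq′ =
    z ∷ xs , ys , refl , cong₂ _∷_ fz≡u eq₁ , eq₂

  lastOf : A → List A → A
  lastOf x []       = x
  lastOf x (y ∷ ys) = lastOf y ys

  linked-++ˡ : ∀ {R : A → A → Set} xs {ys} → Linked R (xs ++ ys) → Linked R xs
  linked-++ˡ []           _        = []
  linked-++ˡ (x ∷ [])     _        = [-]
  linked-++ˡ (x ∷ y ∷ xs) (r ∷ rs) = r ∷ linked-++ˡ (y ∷ xs) rs

  -- The last vertex before the cut is kept in front, so that the first vertex of `ys` still has its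
  -- predecessor in the list.
  linked-++ʳ : ∀ {R : A → A → Set} x xs {ys} → Linked R (x ∷ xs ++ ys) → Linked R (lastOf x xs ∷ ys)
  linked-++ʳ x []       rs       = rs
  linked-++ʳ x (y ∷ xs) (_ ∷ rs) = linked-++ʳ y xs rs

  unique-++ʳ : ∀ x xs {ys : List A} → Unique (x ∷ xs ++ ys) → Unique (lastOf x xs ∷ ys)
  unique-++ʳ x []       unique       = unique
  unique-++ʳ x (y ∷ xs) (_ ∷ unique) = unique-++ʳ y xs unique

  -- Since a path repeats no vertex, predecessor and successor differ; at a vertex of degree two
  -- they are then all the neighbours.
  both-neighbours : ∀ {R : A → A → Set} {x xs v} → Unique (x ∷ xs) → Linked R (x ∷ xs) → v ∈ xs →
    v ≡ lastOf x xs ⊎ ∃₂ λ a b → a ∈ x ∷ xs × b ∈ x ∷ xs × a ≢ b × R a v × R v b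
  both-neighbours {xs = y ∷ []}     _ _ (here refl) = inj₁ refl
  both-neighbours {x = x} {y ∷ z ∷ xs} ((_ ∷ x≢z ∷ _) ∷ _) (r ∷ r′ ∷ _) (here refl) =
    inj₂ (x , z , here refl , there (there (here refl)) , x≢z , r , r′)
  both-neighbours {xs = y ∷ xs} (_ ∷ unique) (_ ∷ rs) (there v∈) with both-neighbours unique rs v∈
  ... | inj₁ eq = inj₁ eq
  ... | inj₂ (a , b , a∈ , b∈ , a≢b , rest) = inj₂ (a , b , there a∈ , there b∈ , a≢b , rest)

occurrences : ∀ {k} → Fin k → List (Fin k) → ℕ
occurrences y []       = 0
occurrences y (x ∷ xs) = indicator x y + occurrences y xs

occurrences-↭ : ∀ {k} (y : Fin k) {xs ys} → xs ↭ ys → occurrences y xs ≡ occurrences y ys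
occurrences-↭ y refl = refl
occurrences-↭ y (prep x p) = cong (indicator x y +_) (occurrences-↭ y p)
occurrences-↭ y (swap {xs} {ys} x z p) = ≡.trans
  (solve 3 (λ a b c → a :+ (b :+ c) := b :+ (a :+ c)) refl (indicator x y) (indicator z y) (occurrences y xs))
  (cong (λ o → indicator z y + (indicator x y + o)) (occurrences-↭ y p))
occurrences-↭ y (trans p q) = ≡.trans (occurrences-↭ y p) (occurrences-↭ y q)

occurrences-filter : ∀ {k} {A : Set} (f : A → Fin k) y xs →
  occurrences y (map f xs) ≡ length (filter (λ v → f v Fin.≟ y) xs)
occurrences-filter f y []       = refl
occurrences-filter f y (x ∷ xs) with f x Fin.≟ y
... | yes _ = cong suc (occurrences-filter f y xs)
... | no  _ = occurrences-filter f y xs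

occurrences-pos : ∀ {k} {A : Set} (f : A → Fin k) {v xs} → v ∈ xs → 0 < occurrences (f v) (map f xs)
occurrences-pos f {v} (here refl) =
  ≤-trans (≤-reflexive (sym (indicator-≡ {i = f v} refl))) (m≤m+n (indicator (f v) (f v)) _)
occurrences-pos f {v} {x ∷ _} (there v∈) = ≤-trans (occurrences-pos f v∈) (m≤n+m _ (indicator (f x) (f v)))

occurrences-find : ∀ {k} {A : Set} (f : A → Fin k) y xs → 0 < occurrences y (map f xs) → ∃ λ v → v ∈ xs × f v ≡ y
occurrences-find f y (x ∷ xs) pos with f x Fin.≟ y
... | yes eq = x , here refl , eq
... | no  _  with v , v∈ , eq ← occurrences-find f y xs pos = v , there v∈ , eq

occurrences-tabulate : ∀ {k} {A : Set} (c : A → Fin k) y n (g : Fin n → A) (f : ℕ → Fin k) →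
  (∀ s → c (g s) ≡ f (toℕ s)) → occurrences y (map c (tabulate g)) ≡ count f y n
occurrences-tabulate c y zero    g f eq = refl
occurrences-tabulate c y (suc n) g f eq = ≡.trans
  (cong₂ (λ x o → indicator x y + o) (eq zero) (occurrences-tabulate c y n (g ∘ suc) (f ∘ suc) (eq ∘ suc)))
  (≡.trans (cong (_+ count (f ∘ suc) y n) (sym (+-identityʳ (indicator (f 0) y)))) (sym (count-+ f y 1 n)))

-- Three values cannot cover four indices. A value may also be 4, the index of an original vertex.
unused-index : ∀ a b c → ∃ λ (j : Fin 4) → toℕ j ≢ a × toℕ j ≢ b × toℕ j ≢ c
unused-index a b c with Fin.any? {4} (λ j → ¬? (toℕ j ≟ a) ×-dec ¬? (toℕ j ≟ b) ×-dec ¬? (toℕ j ≟ c))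
... | yes found = found
... | no ¬found = ⊥-elim (collide (Fin.pigeonhole (≤-refl {4}) (λ j → proj₁ (which j))))
  where
  candidate : Fin 3 → ℕ
  candidate zero             = a
  candidate (suc zero)       = b
  candidate (suc (suc zero)) = c
  which : ∀ (j : Fin 4) → ∃ λ (i : Fin 3) → toℕ j ≡ candidate i
  which j with toℕ j ≟ a | toℕ j ≟ b | toℕ j ≟ c
  ... | yes eq | _      | _      = zero , eq
  ... | no _   | yes eq | _      = suc zero , eq
  ... | no _   | no _   | yes eq = suc (suc zero) , eq
  ... | no ≢a  | no ≢b  | no ≢c  = ⊥-elim (¬found (j , ≢a , ≢b , ≢c))
  collide : ¬ ∃₂ λ i j → toℕ i < toℕ j × proj₁ (which i) ≡ proj₁ (which j)
  collide (i , j , i<j , same) =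
    <⇒≢ i<j (≡.trans (proj₂ (which i)) (≡.trans (cong candidate same) (sym (proj₂ (which j)))))

-- The colouring of the subdivision

module Colouring (G : Graph) where
  open Graph G

  divisions : Fin m → ℕ
  divisions i = 4 * size (toℕ i)

  open Subdivision G divisions

  colour : SV → Fin 8
  colour (inj₁ _)       = zero
  colour (inj₂ (i , t)) = edgeColour (toℕ i) (toℕ t)

  -- The region of a division vertex is one of 0, …, 3; original vertices get the index 4.
  index : SV → ℕ
  index (inj₁ _)       = 4
  index (inj₂ (i , t)) = region (toℕ i) (toℕ t)

  colour-original : ∀ v → colour v ≡ zero → ∃ λ u → v ≡ inj₁ u
  colour-original (inj₁ u)       _  = u , refl
  colour-original (inj₂ (i , t)) eq = ⊥-elim (edgeColour-nonzero (toℕ i) (toℕ t) eq)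

  -- Neighbours of division vertices

  -- `Below` and `Above` are the two directions along edge `i`. Each determines its vertex, hence
  -- division vertices have degree two.
  data Below (i : Fin m) (t : Fin (divisions i)) : SV → Set where
    start : toℕ t ≡ 0 → Below i t (inj₁ (proj₁ (ends i)))
    prev  : ∀ t′ → toℕ t ≡ suc (toℕ t′) → Below i t (inj₂ (i , t′))

  data Above (i : Fin m) (t : Fin (divisions i)) : SV → Set where
    end  : suc (toℕ t) ≡ divisions i → Above i t (inj₁ (proj₂ (ends i)))
    next : ∀ t′ → toℕ t′ ≡ suc (toℕ t) → Above i t (inj₂ (i , t′))

  below-unique : ∀ {i t v w} → Below i t v → Below i t w → v ≡ w
  below-unique (start _)   (start _)    = refl
  below-unique (start eq)  (prev _ eq′) with () ← ≡.trans (sym eq) eq′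
  below-unique (prev _ eq) (start eq′)  with () ← ≡.trans (sym eq) eq′
  below-unique (prev _ eq) (prev _ eq′) =
    cong (λ t → inj₂ (_ , t)) (Fin.toℕ-injective (suc-injective (≡.trans (sym eq) eq′)))

  above-unique : ∀ {i t v w} → Above i t v → Above i t w → v ≡ w
  above-unique (end _) (end _) = refl
  above-unique (end eq) (next t′ eq′) = ⊥-elim (<⇒≢ (Fin.toℕ<n t′) (≡.trans eq′ eq))
  above-unique (next t′ eq′) (end eq) = ⊥-elim (<⇒≢ (Fin.toℕ<n t′) (≡.trans eq′ eq))
  above-unique (next _ eq) (next _ eq′) =
    cong (λ t → inj₂ (_ , t)) (Fin.toℕ-injective (≡.trans eq (sym eq′)))

  neighbour : ∀ {i t w} → SAdj (inj₂ (i , t)) w → Below i t w ⊎ Above i t w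
  neighbour (inj₁ (middle _ _ t′ eq)) = inj₂ (next t′ eq)
  neighbour (inj₁ (last _ _ eq))      = inj₂ (end eq)
  neighbour (inj₂ (first _ _ eq))     = inj₁ (start eq)
  neighbour (inj₂ (middle _ t′ _ eq)) = inj₁ (prev t′ eq)

  adj-sym : ∀ {v w} → SAdj v w → SAdj w v
  adj-sym (inj₁ s) = inj₂ s
  adj-sym (inj₂ s) = inj₁ s

  degree-two : ∀ {i t a b c} → SAdj (inj₂ (i , t)) a → SAdj (inj₂ (i , t)) b → a ≢ b →
    SAdj (inj₂ (i , t)) c → c ≡ a ⊎ c ≡ b
  degree-two va vb a≢b vc with neighbour va | neighbour vb | neighbour vc
  ... | inj₁ a↓ | inj₁ b↓ | _       = ⊥-elim (a≢b (below-unique a↓ b↓))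
  ... | inj₂ a↑ | inj₂ b↑ | _       = ⊥-elim (a≢b (above-unique a↑ b↑))
  ... | inj₁ a↓ | inj₂ b↑ | inj₁ c↓ = inj₁ (below-unique c↓ a↓)
  ... | inj₁ a↓ | inj₂ b↑ | inj₂ c↑ = inj₂ (above-unique c↑ b↑)
  ... | inj₂ a↑ | inj₁ b↓ | inj₁ c↓ = inj₂ (below-unique c↓ b↓)
  ... | inj₂ a↑ | inj₁ b↓ | inj₂ c↑ = inj₁ (above-unique c↑ a↑)

  -- Halves that contain all or nothing of a region

  Closed : ℕ → List SV → Set
  Closed j H = ∀ {v w} → v ∈ H → index v ≡ j → SAdj v w → index w ≡ j → w ∈ H

  -- A vertex of `H` with index `j` is a division vertex and not the last of the path, so both its
  -- neighbours are on the path.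
  path-closed : ∀ {j x H} → j < 4 → IsPath SAdj (x ∷ H) → j ≢ index x → j ≢ index (lastOf x H) →
    ∀ {v w} → v ∈ H → index v ≡ j → SAdj v w → index w ≡ j → w ∈ x ∷ H
  path-closed j<4 (unique , linked) _ ≢last {v} v∈ v-j vw w-j with both-neighbours unique linked v∈
  path-closed j<4 _ _ ≢last {v} v∈ v-j vw w-j | inj₁ refl = ⊥-elim (≢last (sym v-j))
  path-closed j<4 _ _ ≢last {inj₁ _} v∈ refl vw w-j | inj₂ _ = ⊥-elim (<-irrefl refl j<4)
  path-closed j<4 _ _ ≢last {inj₂ _} v∈ v-j vw w-j | inj₂ (a , b , a∈ , b∈ , a≢b , av , vb)
    with degree-two (adj-sym av) vb a≢b vw
  ... | inj₁ refl = a∈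
  ... | inj₂ refl = b∈

  closed-front : ∀ {j x H} → j < 4 → IsPath SAdj (x ∷ H) → j ≢ index x → j ≢ index (lastOf x H) → Closed j (x ∷ H)
  closed-front j<4 path ≢x ≢last (here refl) v-j  = ⊥-elim (≢x (sym v-j))
  closed-front j<4 path ≢x ≢last (there v∈)  v-j  = path-closed j<4 path ≢x ≢last v∈ v-j

  -- Meant for the second half `H` of a path, with `x` the last vertex of the first half: as `x`
  -- does not have index `j`, the neighbours found lie in `H` itself.
  closed-back : ∀ {j x H} → j < 4 → IsPath SAdj (x ∷ H) → j ≢ index x → j ≢ index (lastOf x H) → Closed j H
  closed-back j<4 path ≢x ≢last v∈ v-j vw w-j with path-closed j<4 path ≢x ≢last v∈ v-j vw w-j
  ... | here refl = ⊥-elim (≢x (sym w-j))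
  ... | there w∈  = w∈

  division-between : ∀ {i} (t : Fin (divisions i)) {s} → s < toℕ t → ∃ λ (t′ : Fin (divisions i)) → toℕ t′ ≡ s
  division-between t s<t = fromℕ< (<-trans s<t (Fin.toℕ<n t)) , Fin.toℕ-fromℕ< _

  -- One step along the edge at a time; the region number is monotone, so everything between `t` and
  -- `t′` has index `j` too.
  closed-up : ∀ {j H i} d (t t′ : Fin (divisions i)) → Closed j H → toℕ t′ ≡ d + toℕ t →
    region (toℕ i) (toℕ t) ≡ j → region (toℕ i) (toℕ t′) ≡ j → inj₂ (i , t) ∈ H → inj₂ (i , t′) ∈ H
  closed-up {H = H} {i} zero t t′ closed eq _ _ t∈ = subst (λ s → inj₂ (i , s) ∈ H) (Fin.toℕ-injective (sym eq)) t∈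
  closed-up {j} {i = i} (suc d) t t′ closed eq t-j t′-j t∈ with division-between {i} t′ (≤-reflexive (sym eq))
  ... | s , s≡ = closed (closed-up {i = i} d t s closed s≡ t-j s-j t∈) s-j (inj₁ (middle i s t′ (≡.trans eq (cong suc (sym s≡))))) t′-j
    where
    s-j : region (toℕ i) (toℕ s) ≡ j
    s-j = ≤-antisym
      (≤-trans (region-mono (toℕ i) (≤-trans (≤-reflexive s≡) (≤-trans (n≤1+n _) (≤-reflexive (sym eq))))) (≤-reflexive t′-j))
      (≤-trans (≤-reflexive (sym t-j)) (region-mono (toℕ i) (≤-trans (m≤n+m (toℕ t) d) (≤-reflexive (sym s≡)))))

  closed-down : ∀ {j H i} d (t t′ : Fin (divisions i)) → Closed j H → toℕ t′ ≡ d + toℕ t →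
    region (toℕ i) (toℕ t) ≡ j → region (toℕ i) (toℕ t′) ≡ j → inj₂ (i , t′) ∈ H → inj₂ (i , t) ∈ H
  closed-down {H = H} {i} zero t t′ closed eq _ _ t′∈ = subst (λ s → inj₂ (i , s) ∈ H) (Fin.toℕ-injective eq) t′∈
  closed-down {j} {i = i} (suc d) t t′ closed eq t-j t′-j t′∈ with division-between {i} t′ (≤-reflexive (sym eq))
  ... | s , s≡ = closed-down {i = i} d t s closed s≡ t-j s-j (closed t′∈ t′-j (inj₂ (middle i s t′ (≡.trans eq (cong suc (sym s≡))))) s-j)
    where
    s-j : region (toℕ i) (toℕ s) ≡ j
    s-j = ≤-antisym
      (≤-trans (region-mono (toℕ i) (≤-trans (≤-reflexive s≡) (≤-trans (n≤1+n _) (≤-reflexive (sym eq))))) (≤-reflexive t′-j))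
      (≤-trans (≤-reflexive (sym t-j)) (region-mono (toℕ i) (≤-trans (m≤n+m (toℕ t) d) (≤-reflexive (sym s≡)))))

  closed-region : ∀ {j H i} (t t′ : Fin (divisions i)) → Closed j H →
    region (toℕ i) (toℕ t) ≡ j → region (toℕ i) (toℕ t′) ≡ j → inj₂ (i , t) ∈ H → inj₂ (i , t′) ∈ H
  closed-region {i = i} t t′ closed t-j t′-j t∈ with ≤-total (toℕ t) (toℕ t′)
  ... | inj₁ t≤t′ = closed-up   {i = i} (toℕ t′ ∸ toℕ t) t t′ closed (sym (m∸n+n≡m t≤t′)) t-j t′-j t∈
  ... | inj₂ t′≤t = closed-down {i = i} (toℕ t ∸ toℕ t′) t′ t closed (sym (m∸n+n≡m t′≤t)) t′-j t-j t∈

  -- No balanced path meets a region with the chosen number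

  inRegion : Fin 4 → (i : Fin m) → Fin (size (toℕ i)) → SV
  inRegion j i s = inj₂ (i , combine {4} {size (toℕ i)} j s)

  combine≡ : ∀ (j : Fin 4) (i : Fin m) (s : Fin (size (toℕ i))) → toℕ (combine {4} {size (toℕ i)} j s) ≡ toℕ j * size (toℕ i) + toℕ s
  combine≡ j i s = ≡.trans (Fin.toℕ-combine {4} {size (toℕ i)} j s) (cong (_+ toℕ s) (*-comm (size (toℕ i)) (toℕ j)))

  index-inRegion : ∀ j i s → index (inRegion j i s) ≡ toℕ j
  index-inRegion j i s = ≡.trans (cong (region (toℕ i)) (combine≡ j i s)) (region-block (toℕ i) (toℕ j) (Fin.toℕ<n s))

  colour-inRegion : ∀ j i s → colour (inRegion j i s) ≡ tint (toℕ j) (K (toℕ i) (toℕ s))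
  colour-inRegion j i s =
    ≡.trans (cong (edgeColour (toℕ i)) (combine≡ j i s)) (edgeColour-block (toℕ i) (toℕ j) (Fin.toℕ<n s))

  inRegion-surjective : ∀ {j i t} → index (inj₂ (i , t)) ≡ toℕ j → ∃ λ s → inj₂ (i , t) ≡ inRegion j i s
  inRegion-surjective {j} {i} {t} eq = s , sym (≡.trans (cong (λ k → inRegion k i s) j≡j′) t≡)
    where
    j′ = proj₁ (remQuot {4} (size (toℕ i)) t)
    s = proj₂ (remQuot {4} (size (toℕ i)) t)
    t≡ : inRegion j′ i s ≡ inj₂ (i , t)
    t≡ = cong (λ t → inj₂ (i , t)) (Fin.combine-remQuot {4} (size (toℕ i)) t)
    j≡j′ : j ≡ j′
    j≡j′ = Fin.toℕ-injective (≡.trans (sym eq) (≡.trans (cong index (sym t≡)) (index-inRegion j′ i s)))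

  inRegion-injective : ∀ j i {s s′} → inRegion j i s ≡ inRegion j i s′ → s ≡ s′
  inRegion-injective j i {s} {s′} eq = proj₂ (Fin.combine-injective {4} {size (toℕ i)} j s j s′ (division-injective eq))
    where
    division-injective : ∀ {t t′ : Fin (divisions i)} → _≡_ {A = SV} (inj₂ (i , t)) (inj₂ (i , t′)) → t ≡ t′
    division-injective refl = refl

  index-mark : ∀ (j : Fin 4) v → colour v ≡ mark (toℕ j) → ∃₂ λ i t → v ≡ inj₂ (i , t) × region (toℕ i) (toℕ t) ≡ toℕ j
  index-mark j (inj₂ (i , t)) eq = i , t , refl , edgeColour-mark (toℕ i) (Fin.toℕ<n t) (Fin.toℕ<n j) eq

  regionsBelow : Fin 4 → ∀ b → b ≤ m → List SV
  regionsBelow j zero    _   = []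
  regionsBelow j (suc b) b<m = tabulate (inRegion j (fromℕ< b<m)) ++ regionsBelow j b (<⇒≤ b<m)

  length-regionsBelow : ∀ j b b≤m → length (regionsBelow j b b≤m) ≡ geometric b
  length-regionsBelow j zero    _   = refl
  length-regionsBelow j (suc b) b<m = ≡.trans (length-++ (tabulate (inRegion j (fromℕ< b<m)))) (cong₂ _+_
    (≡.trans (length-tabulate (inRegion j (fromℕ< b<m))) (cong size (Fin.toℕ-fromℕ< b<m)))
    (length-regionsBelow j b (<⇒≤ b<m)))

  ∈-regionsBelow : ∀ {j i t} b b≤m → toℕ i < b → index (inj₂ (i , t)) ≡ toℕ j → inj₂ (i , t) ∈ regionsBelow j b b≤m
  ∈-regionsBelow {j} {i} {t} (suc b) b<m i<b eq with m≤n⇒m<n∨m≡n (s≤s⁻¹ i<b)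
  ... | inj₁ i<b′ = ∈-++⁺ʳ (tabulate (inRegion j (fromℕ< b<m))) (∈-regionsBelow b (<⇒≤ b<m) i<b′ eq)
  ... | inj₂ refl with s , t≡ ← inRegion-surjective {j} {i} {t} eq =
    ∈-++⁺ˡ (subst₂ (λ v k → v ∈ tabulate (inRegion j k)) (sym t≡) (Fin.toℕ-injective (sym (Fin.toℕ-fromℕ< b<m)))
      (∈-tabulate⁺ {f = inRegion j i} s))

  -- The marks of one region outnumber those of all regions of smaller edges together.
  dominates : ∀ (j : Fin 4) {A B i t} → Closed (toℕ j) A → Unique B → Disjoint A B →
    inj₂ (i , t) ∈ A → index (inj₂ (i , t)) ≡ toℕ j →
    (∀ {i′ t′} → inj₂ (i′ , t′) ∈ B → index (inj₂ (i′ , t′)) ≡ toℕ j → toℕ i′ ≤ toℕ i) →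
    occurrences (mark (toℕ j)) (map colour B) < occurrences (mark (toℕ j)) (map colour A)
  dominates j {A} {B} {i} {t} closed uniqueB disjoint t∈ t-j largest = begin-strict
    occurrences c (map colour B)                            ≡⟨ occurrences-filter colour c B ⟩
    length (filter c? B)                                    ≤⟨ unique-⊆-length (Unique.filter⁺ c? uniqueB) B⊆ ⟩
    length (regionsBelow j (toℕ i) (<⇒≤ (Fin.toℕ<n i)))     ≡⟨ length-regionsBelow j (toℕ i) (<⇒≤ (Fin.toℕ<n i)) ⟩
    geometric (toℕ i)                                       <⟨ geometric<count (toℕ i) ⟩
    count (K (toℕ i)) 𝕒 (size (toℕ i))                      ≡⟨ count-injective (tint (toℕ j)) (tint-injective (toℕ j)) (K (toℕ i)) 𝕒 (size (toℕ i)) ⟨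
    count (tint (toℕ j) ∘ K (toℕ i)) c (size (toℕ i))       ≡⟨ occurrences-tabulate colour c (size (toℕ i)) (inRegion j i) (tint (toℕ j) ∘ K (toℕ i)) (colour-inRegion j i) ⟨
    occurrences c (map colour marked)                       ≡⟨ occurrences-filter colour c marked ⟩
    length (filter c? marked)                               ≤⟨ unique-⊆-length (Unique.filter⁺ c? (Unique.tabulate⁺ (inRegion-injective j i))) ⊆A ⟩
    length (filter c? A)                                    ≡⟨ occurrences-filter colour c A ⟨
    occurrences c (map colour A)                            ∎
    where
    open ≤-Reasoning
    c = mark (toℕ j)
    c? : ∀ v → Dec (colour v ≡ c)
    c? v = colour v Fin.≟ c
    marked = tabulate (inRegion j i)

    region⊆A : ∀ s → inRegion j i s ∈ A
    region⊆A s = closed-region {i = i} t (combine {4} {size (toℕ i)} j s) closed t-j (index-inRegion j i s) t∈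

    ⊆A : ∀ {v} → v ∈ filter c? marked → v ∈ filter c? A
    ⊆A v∈ with v∈marked , v-c ← ∈-filter⁻ c? {xs = marked} v∈ with s , refl ← ∈-tabulate⁻ v∈marked =
      ∈-filter⁺ c? (region⊆A s) v-c

    B⊆ : ∀ {v} → v ∈ filter c? B → v ∈ regionsBelow j (toℕ i) (<⇒≤ (Fin.toℕ<n i))
    B⊆ {v} v∈ with v∈B , v-c ← ∈-filter⁻ c? {xs = B} v∈ with i′ , t′ , refl , t′-j ← index-mark j v v-c =
      ∈-regionsBelow (toℕ i) (<⇒≤ (Fin.toℕ<n i)) (≤∧≢⇒< (largest v∈B t′-j) i′≢i) t′-j
      where
      -- On edge `i` itself, `A` contains the whole region and leaves nothing for `B`.
      i′≢i : toℕ i′ ≢ toℕ i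
      i′≢i eq with refl ← Fin.toℕ-injective eq = disjoint (closed-region {i = i} t t′ closed t-j t′-j t∈ , v∈B)

  -- The half that meets the region on the largest edge contains all of it and so has more marks
  -- than the other half.
  ¬largest : ∀ (j : Fin 4) {L R i t} → Closed (toℕ j) L → Closed (toℕ j) R → Unique (L ++ R) →
    (∀ y → occurrences y (map colour L) ≡ occurrences y (map colour R)) →
    (∀ {i′ t′} → inj₂ (i′ , t′) ∈ L ++ R → index (inj₂ (i′ , t′)) ≡ toℕ j → toℕ i′ ≤ toℕ i) →
    inj₂ (i , t) ∈ L ++ R → index (inj₂ (i , t)) ≢ toℕ j
  ¬largest j {L} {R} closedL closedR unique bal largest t∈ t-j
    with uniqueL , uniqueR , disjoint ← unique-++⁻ L unique | ∈-++⁻ L t∈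
  ... | inj₁ t∈L = <⇒≢ (dominates j closedL uniqueR disjoint t∈L t-j (largest ∘ ∈-++⁺ʳ L)) (sym (bal _))
  ... | inj₂ t∈R = <⇒≢ (dominates j closedR uniqueL (λ { (v∈R , v∈L) → disjoint (v∈L , v∈R) }) t∈R t-j (largest ∘ ∈-++⁺ˡ)) (bal _)

  -- Since no edge can be the largest one met, the bound `b` on the edge numbers descends to 0.
  avoids : ∀ (j : Fin 4) {L R} → Closed (toℕ j) L → Closed (toℕ j) R → Unique (L ++ R) →
    (∀ y → occurrences y (map colour L) ≡ occurrences y (map colour R)) →
    ∀ b → (∀ {i t} → inj₂ (i , t) ∈ L ++ R → index (inj₂ (i , t)) ≡ toℕ j → toℕ i < b) →
    ∀ {i t} → inj₂ (i , t) ∈ L ++ R → index (inj₂ (i , t)) ≢ toℕ j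
  avoids j closedL closedR unique bal zero    below t∈ t-j = n≮0 (below t∈ t-j)
  avoids j closedL closedR unique bal (suc b) below = avoids j closedL closedR unique bal b λ {i} {t} t∈ t-j →
    ≤∧≢⇒< (s≤s⁻¹ (below t∈ t-j)) λ { refl → ¬largest j {i = i} {t} closedL closedR unique bal (λ t′∈ t′-j → s≤s⁻¹ (below t′∈ t′-j)) t∈ t-j }

  -- The end of its edge on whose side of region j a vertex lies.
  side : ℕ → SV → Fin n
  side j (inj₁ u) = u
  side j (inj₂ (i , t)) with region (toℕ i) (toℕ t) <? j
  ... | yes _ = proj₁ (ends i)
  ... | no  _ = proj₂ (ends i)

  side-< : ∀ {j i t} → region (toℕ i) (toℕ t) < j → side j (inj₂ (i , t)) ≡ proj₁ (ends i)
  side-< {j} {i} {t} lt with region (toℕ i) (toℕ t) <? j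
  ... | yes _  = refl
  ... | no ¬lt = ⊥-elim (¬lt lt)

  side-≮ : ∀ {j i t} → ¬ region (toℕ i) (toℕ t) < j → side j (inj₂ (i , t)) ≡ proj₂ (ends i)
  side-≮ {j} {i} {t} ¬lt with region (toℕ i) (toℕ t) <? j
  ... | yes lt = ⊥-elim (¬lt lt)
  ... | no  _  = refl

  -- One step raises the region number by at most one, so getting from one side of region `j` to the
  -- other would pass through it.
  side-step : ∀ {j v w} → j < 4 → index v ≢ j → index w ≢ j → Step v w → side j v ≡ side j w
  -- Every edge has division vertices.
  side-step _ _ _ (direct i eq) = ⊥-elim (<⇒≢ (≤-trans (>-nonZero⁻¹ (size (toℕ i)) {{size≢0 (toℕ i)}}) (m≤m+n (size (toℕ i)) _)) (sym eq))
  side-step {j} _ _ ≢j (first i t eq) = sym (side-< {t = t} (≤∧≢⇒< (≤-trans (≤-reflexive zero-region) z≤n) ≢j))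
    where
    zero-region : region (toℕ i) (toℕ t) ≡ 0
    zero-region = ≡.trans (cong (region (toℕ i)) eq) (region-block (toℕ i) 0 (>-nonZero⁻¹ (size (toℕ i)) {{size≢0 (toℕ i)}}))
  side-step {j} _ v≢j w≢j (middle i t t′ eq) with region (toℕ i) (toℕ t) <? j
  ... | yes lt = sym (side-< {t = t′} (≤∧≢⇒< (≤-trans (≤-reflexive (cong (region (toℕ i)) eq)) (≤-trans (region-suc (toℕ i) (toℕ t)) lt)) w≢j))
  ... | no ¬lt = sym (side-≮ {t = t′} λ lt → ¬lt (≤-<-trans (region-mono (toℕ i) (≤-trans (n≤1+n (toℕ t)) (≤-reflexive (sym eq)))) lt))
  side-step {j} j<4 v≢j _ (last i t eq) = side-≮ {t = t} λ lt → v≢j (≤-antisym (<⇒≤ lt) (≤-trans (s≤s⁻¹ j<4) (region-≥ (toℕ i) 3 last-region)))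
    where
    last-region : 3 * size (toℕ i) ≤ toℕ t
    last-region = s≤s⁻¹ (≤-trans (+-monoˡ-≤ (3 * size (toℕ i)) (>-nonZero⁻¹ (size (toℕ i)) {{size≢0 (toℕ i)}})) (≤-reflexive (sym eq)))

  side-adj : ∀ {j v w} → j < 4 → index v ≢ j → index w ≢ j → SAdj v w → side j v ≡ side j w
  side-adj j<4 v≢j w≢j (inj₁ s) = side-step j<4 v≢j w≢j s
  side-adj j<4 v≢j w≢j (inj₂ s) = sym (side-step j<4 w≢j v≢j s)

  side-constant : ∀ {j x H} → j < 4 → Linked SAdj (x ∷ H) → (∀ {v} → v ∈ x ∷ H → index v ≢ j) →
    ∀ {v} → v ∈ x ∷ H → side j v ≡ side j x
  side-constant j<4 linked avoid (here refl) = refl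
  side-constant j<4 (r ∷ linked) avoid (there v∈) = ≡.trans (side-constant j<4 linked (avoid ∘ there) v∈)
    (sym (side-adj j<4 (avoid (here refl)) (avoid (there (here refl))) r))

  -- An original vertex is its own side and the side is constant along the path, so the path has at
  -- most one. Colour 0 is balanced and belongs to original vertices alone, so one in `A` would
  -- force another in `B`.
  no-originals : ∀ {j x H} → j < 4 → Linked SAdj (x ∷ H) → (∀ {v} → v ∈ x ∷ H → index v ≢ j) →
    ∀ {A B} → (∀ {v} → v ∈ A → v ∈ x ∷ H) → (∀ {v} → v ∈ B → v ∈ x ∷ H) → Disjoint A B →
    occurrences zero (map colour A) ≡ occurrences zero (map colour B) → ∀ u → inj₁ u ∉ A
  no-originals {j} j<4 linked avoid {A} {B} A⊆ B⊆ disjoint bal u u∈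
    with v , v∈ , v≡ ← occurrences-find colour zero B (subst (0 <_) bal (occurrences-pos colour u∈))
    with u′ , refl ← colour-original v v≡
    with refl ← ≡.trans (side-constant j<4 linked avoid (A⊆ u∈)) (sym (side-constant j<4 linked avoid (B⊆ v∈))) =
    disjoint (u∈ , v∈)

  -- Monotone runs along one edge

  -- `Up` runs through the positions from `s` to `s′ - 1`, and `Down` from `s - 1` to `s′`. The
  -- intervals are half-open to match prefix counts.
  data Up (i : Fin m) : ℕ → ℕ → List SV → Set where
    []  : ∀ {s} → Up i s s []
    _∷_ : ∀ {t s s′ H} → toℕ t ≡ s → Up i (suc s) s′ H → Up i s s′ (inj₂ (i , t) ∷ H)

  data Down (i : Fin m) : ℕ → ℕ → List SV → Set where
    []  : ∀ {s} → Down i s s []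
    _∷_ : ∀ {t s s′ H} → toℕ t ≡ s → Down i s s′ H → Down i (suc s) s′ (inj₂ (i , t) ∷ H)

  -- The preceding vertex `t₀` fixes the direction: turning back would repeat it.
  up-run : ∀ {i t₀ t} H → toℕ t ≡ suc (toℕ t₀) → Unique (inj₂ (i , t₀) ∷ inj₂ (i , t) ∷ H) →
    Linked SAdj (inj₂ (i , t) ∷ H) → (∀ u → inj₁ u ∉ H) → ∃ λ s → Up i (toℕ t) s (inj₂ (i , t) ∷ H)
  up-run [] _ _ _ _ = _ , refl ∷ []
  up-run (inj₁ u ∷ H) _ _ _ none = ⊥-elim (none u (here refl))
  up-run {i} {t = t} (inj₂ (_ , z) ∷ H) eq (_ ∷ unique) (inj₁ (middle _ _ _ z≡) ∷ linked) none
    with s , up ← up-run H z≡ unique linked (λ u → none u ∘ there) = s , refl ∷ subst (λ r → Up i r s _) z≡ up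
  up-run (inj₂ (_ , z) ∷ H) eq ((_ ∷ ≢z ∷ _) ∷ _) (inj₂ (middle _ _ _ t≡) ∷ linked) none =
    ⊥-elim (≢z (cong (λ t → inj₂ (_ , t)) (Fin.toℕ-injective (suc-injective (≡.trans (sym eq) t≡)))))

  down-run : ∀ {i t₀ t} H → toℕ t₀ ≡ suc (toℕ t) → Unique (inj₂ (i , t₀) ∷ inj₂ (i , t) ∷ H) →
    Linked SAdj (inj₂ (i , t) ∷ H) → (∀ u → inj₁ u ∉ H) → ∃ λ s → Down i (suc (toℕ t)) s (inj₂ (i , t) ∷ H)
  down-run [] _ _ _ _ = _ , refl ∷ []
  down-run (inj₁ u ∷ H) _ _ _ none = ⊥-elim (none u (here refl))
  down-run {i} {t = t} (inj₂ (_ , z) ∷ H) eq (_ ∷ unique) (inj₂ (middle _ _ _ t≡) ∷ linked) none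
    with s , down ← down-run H t≡ unique linked (λ u → none u ∘ there) = s , refl ∷ subst (λ r → Down i r s _) (sym t≡) down
  down-run (inj₂ (_ , z) ∷ H) eq ((_ ∷ ≢z ∷ _) ∷ _) (inj₁ (middle _ _ _ z≡) ∷ linked) none =
    ⊥-elim (≢z (cong (λ t → inj₂ (_ , t)) (Fin.toℕ-injective (≡.trans eq (sym z≡)))))

  run : ∀ {x H} → IsPath SAdj (x ∷ H) → (∀ u → inj₁ u ∉ x ∷ H) →
    ∃₂ λ i s → ∃ λ s′ → Up i s s′ (x ∷ H) ⊎ Down i s s′ (x ∷ H)
  run {inj₁ u} _ none = ⊥-elim (none u (here refl))
  run {inj₂ (i , t)} {[]} _ _ = i , toℕ t , suc (toℕ t) , inj₁ (refl ∷ [])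
  run {inj₂ (i , t)} {inj₁ u ∷ H} _ none = ⊥-elim (none u (there (here refl)))
  run {inj₂ (i , t)} {inj₂ (_ , z) ∷ H} (unique , inj₁ (middle _ _ _ z≡) ∷ linked) none
    with s , up ← up-run H z≡ unique linked (λ u → none u ∘ there ∘ there) =
    i , toℕ t , s , inj₁ (refl ∷ subst (λ r → Up i r s _) z≡ up)
  run {inj₂ (i , t)} {inj₂ (_ , z) ∷ H} (unique , inj₂ (middle _ _ _ t≡) ∷ linked) none
    with s , down ← down-run H t≡ unique linked (λ u → none u ∘ there ∘ there) =
    i , suc (toℕ t) , s , inj₂ (refl ∷ subst (λ r → Down i r s _) (sym t≡) down)

  up-++⁻ : ∀ {i s s′} L {R} → Up i s s′ (L ++ R) → ∃ λ r → Up i s r L × Up i r s′ R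
  up-++⁻ []      up         = _ , [] , up
  up-++⁻ (x ∷ L) (eq ∷ up) with r , upL , upR ← up-++⁻ L up = r , eq ∷ upL , upR

  down-++⁻ : ∀ {i s s′} L {R} → Down i s s′ (L ++ R) → ∃ λ r → Down i s r L × Down i r s′ R
  down-++⁻ []      down         = _ , [] , down
  down-++⁻ (x ∷ L) (eq ∷ down) with r , downL , downR ← down-++⁻ L down = r , eq ∷ downL , downR

  up-≤ : ∀ {i s s′ H} → Up i s s′ H → s ≤ s′
  up-≤ []       = ≤-refl
  up-≤ (_ ∷ up) = ≤-trans (n≤1+n _) (up-≤ up)

  down-≤ : ∀ {i s s′ H} → Down i s s′ H → s′ ≤ s
  down-≤ []         = ≤-refl
  down-≤ (_ ∷ down) = ≤-trans (down-≤ down) (n≤1+n _)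

  up-< : ∀ {i s s′ H} → H ≢ [] → Up i s s′ H → s < s′
  up-< ≢[] []       = ⊥-elim (≢[] refl)
  up-< _   (_ ∷ up) = up-≤ up

  down-< : ∀ {i s s′ H} → H ≢ [] → Down i s s′ H → s′ < s
  down-< ≢[] []         = ⊥-elim (≢[] refl)
  down-< _   (_ ∷ down) = s≤s (down-≤ down)

  up-bound : ∀ {i s s′ H} → H ≢ [] → Up i s s′ H → s′ ≤ divisions i
  up-bound ≢[] [] = ⊥-elim (≢[] refl)
  up-bound _ (_∷_ {t} refl [])         = Fin.toℕ<n t
  up-bound _ (_ ∷ up@(_ ∷ _)) = up-bound (λ ()) up

  down-bound : ∀ {i s s′ H} → H ≢ [] → Down i s s′ H → s ≤ divisions i
  down-bound ≢[] [] = ⊥-elim (≢[] refl)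
  down-bound _ (_∷_ {t} refl _) = Fin.toℕ<n t

  up-count : ∀ {i s s′ H} y → Up i s s′ H →
    count (edgeColour (toℕ i)) y s + occurrences y (map colour H) ≡ count (edgeColour (toℕ i)) y s′
  up-count y [] = +-identityʳ _
  up-count {i} y (_∷_ {t} {H = H} refl up) = ≡.trans
    (solve 3 (λ c x o → c :+ (x :+ o) := (x :+ c) :+ o) refl
      (count (edgeColour (toℕ i)) y (toℕ t)) (indicator (edgeColour (toℕ i) (toℕ t)) y) (occurrences y (map colour H)))
    (up-count y up)

  down-count : ∀ {i s s′ H} y → Down i s s′ H →
    count (edgeColour (toℕ i)) y s′ + occurrences y (map colour H) ≡ count (edgeColour (toℕ i)) y s
  down-count y [] = +-identityʳ _
  down-count {i} {s′ = s′} y (_∷_ {t} {H = H} refl down) = ≡.trans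
    (solve 3 (λ c x o → c :+ (x :+ o) := x :+ (c :+ o)) refl
      (count (edgeColour (toℕ i)) y s′) (indicator (edgeColour (toℕ i) (toℕ t)) y) (occurrences y (map colour H)))
    (cong (indicator (edgeColour (toℕ i) (toℕ t)) y +_) (down-count y down))

  balanced-run : ∀ {a b c p q} → a + p ≡ b → b + q ≡ c → p ≡ q → a + c ≡ 2 * b
  balanced-run {a} {p = p} refl refl refl = solve 2 (λ a p → a :+ (a :+ p :+ p) := con 2 :* (a :+ p)) refl a p

  colour-anagramFree : AnagramFree SAdj colour
  colour-anagramFree p path (W , P , W≢[] , P↭W , eq) with map-≡-++ colour p {W} {P} eq
  ... | [] , R , refl , refl , refl = W≢[] refl
  ... | L@(x ∷ L′) , R , refl , refl , refl = within (run path originals)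
    where
    unique = proj₁ path
    linked = proj₂ path
    uniqueLR = unique-++⁻ L unique
    disjoint = proj₂ (proj₂ uniqueLR)
    y = lastOf x L′
    -- `lastOf y R` is the last vertex of the whole path.
    chosen = unused-index (index x) (index y) (index (lastOf y R))
    j = proj₁ chosen
    j≢x = proj₁ (proj₂ chosen)
    j≢y = proj₁ (proj₂ (proj₂ chosen))
    j≢z = proj₂ (proj₂ (proj₂ chosen))
    j<4 = Fin.toℕ<n j
    bal : ∀ c → occurrences c (map colour L) ≡ occurrences c (map colour R)
    bal c = sym (occurrences-↭ c P↭W)
    closedL : Closed (toℕ j) L
    closedL = closed-front j<4 (proj₁ uniqueLR , linked-++ˡ L linked) j≢x j≢y
    closedR : Closed (toℕ j) R
    closedR = closed-back j<4 (unique-++ʳ x L′ unique , linked-++ʳ x L′ linked) j≢y j≢z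
    avoid : ∀ {v} → v ∈ L ++ R → index v ≢ toℕ j
    avoid {inj₁ _} _ eq = <⇒≢ j<4 (sym eq)
    avoid {inj₂ (i , t)} v∈ = avoids j closedL closedR unique bal m (λ {i} _ _ → Fin.toℕ<n i) v∈
    originals : ∀ u → inj₁ u ∉ L ++ R
    originals u u∈ with ∈-++⁻ L u∈
    ... | inj₁ u∈L = no-originals j<4 linked avoid ∈-++⁺ˡ (∈-++⁺ʳ L) disjoint (bal zero) u u∈L
    ... | inj₂ u∈R = no-originals j<4 linked avoid (∈-++⁺ʳ L) ∈-++⁺ˡ (λ { (v∈R , v∈L) → disjoint (v∈L , v∈R) }) (sym (bal zero)) u u∈R
    R≢[] : R ≢ []
    R≢[] refl with () ← ↭-length P↭W
    within : (∃₂ λ i s → ∃ λ s′ → Up i s s′ (L ++ R) ⊎ Down i s s′ (L ++ R)) → ⊥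
    within (i , s , s′ , inj₁ up) with r , upL , upR ← up-++⁻ L up =
      edge-squareFree (toℕ i) (up-< (λ ()) upL) (up-< R≢[] upR) (up-bound R≢[] upR) λ c →
        balanced-run (up-count c upL) (up-count c upR) (bal c)
    -- On a descending run `R` has the lower positions, so the halves change places.
    within (i , s , s′ , inj₂ down) with r , downL , downR ← down-++⁻ L down =
      edge-squareFree (toℕ i) (down-< R≢[] downR) (down-< (λ ()) downL) (down-bound (λ ()) downL) λ c →
        balanced-run (down-count c downR) (down-count c downL) (sym (bal c))

-- The number of division vertices

-- Each further edge multiplies the division count by 85 and the bound by (28/3)² = 784/9, which
-- exceeds 87.
withinBound : ∀ {m i} → i < m → WithinBound (2 * m ∸ 1) (4 * size i)
withinBound {suc m} {i} (s≤s i≤m) = begin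
  4 * size i * 3 ^ (2 * suc m ∸ 1)   ≡⟨ cong (λ e → 4 * size i * 3 ^ e) exponent ⟩
  4 * size i * (3 * 3 ^ (2 * m))     ≡⟨ cong (λ q → 4 * size i * (3 * q)) (sym (^-*-assoc 3 2 m)) ⟩
  4 * size i * (3 * 9 ^ m)           ≤⟨ *-monoˡ-≤ (3 * 9 ^ m) (*-monoʳ-≤ 4 (^-monoʳ-≤ 85 i≤m)) ⟩
  4 * 85 ^ m * (3 * 9 ^ m)           ≡⟨ regroup 4 (85 ^ m) 3 (9 ^ m) ⟩
  12 * (85 ^ m * 9 ^ m)              ≡⟨ cong (12 *_) (^-distribʳ-* m 85 9) ⟨
  -- Here 765 = 85 · 9 and 784 = 28², while 12 = 4 · 3 and 1260 = 45 · 28.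
  12 * 765 ^ m                       ≤⟨ *-mono-≤ (m≤m+n 12 1248) (^-monoˡ-≤ m (m≤m+n 765 19)) ⟩
  1260 * 784 ^ m                     ≡⟨ cong (1260 *_) (^-*-assoc 28 2 m) ⟩
  1260 * 28 ^ (2 * m)                ≡⟨ *-assoc 45 28 (28 ^ (2 * m)) ⟩
  45 * 28 ^ suc (2 * m)              ≡⟨ cong (λ e → 45 * 28 ^ e) exponent ⟨
  45 * 28 ^ (2 * suc m ∸ 1)          ∎
  where
  open ≤-Reasoning
  exponent : 2 * suc m ∸ 1 ≡ suc (2 * m)
  exponent = +-suc m (m + 0)
  regroup : ∀ a b c d → a * b * (c * d) ≡ a * c * (b * d)
  regroup = solve 4 (λ a b c d → a :* b :* (c :* d) := a :* c :* (b :* d)) refl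
  ^-distribʳ-* : ∀ m a b → (a * b) ^ m ≡ a ^ m * b ^ m
  ^-distribʳ-* zero    a b = refl
  ^-distribʳ-* (suc m) a b = ≡.trans (cong (a * b *_) (^-distribʳ-* m a b))
    (solve 4 (λ a b p q → a :* b :* (p :* q) := a :* p :* (b :* q)) refl a b (a ^ m) (b ^ m))

theorem6 : (G : Graph) →
    Σ (Fin (Graph.m G) → ℕ) λ k →
    (∀ i → WithinBound (2 * Graph.m G ∸ 1) (k i)) ×
    φ≤ (Subdivision.SAdj G k) 8
theorem6 G = divisions , (λ i → withinBound (Fin.toℕ<n i)) , colour , colour-anagramFree
  where open Colouring G
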